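{- Let $p$ be a prime and $n$ a sufficiently large positive integer with $n^{6}\le p\le n^{C}$ for a fixed constant $C$. For every $n$-element set $X\subset[p]$, $\sum_{x\in X}\mathfrak{e}(x)\le \widetilde{\mathcal{O}}(p)$, i.e. at most $p\cdot(\log n)^{\mathcal{O}(1)}$.
   Context: $[N]=\{0,\dots,N-1\}$; $\mathfrak{m}_p(x)$ is the unique element of $(x+p\mathbb{Z})\cap[0,p)$. For $x\in[p]$, the overlap of $x$ is the number of $a\in\{1,2,\dots,\lceil p/2\rceil-1\}$ with $\mathfrak{m}_p(ax)<p/2$, and the excess overlap $\mathfrak{e}(x)$ is the overlap of $x$ minus $p/4$. -}

module Defs where

open import Data.Nat using (ℕ; zero; suc; _+_; _*_; _∸_; _<?_; _/_; _%_)
open import Data.List using (List; []; _∷_; filter; length; applyUpTo)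
open import Data.Fin using (Fin; toℕ)
open import Data.Integer using (ℤ; +_; _-_) renaming (_+_ to _+ℤ_)

-- ovl p x = overlap of x modulo p: number of a in 1 .. ⌈p/2⌉ - 1 with 2 * ((a x) mod p) < p;  ⌈p/2⌉ = (p + 1) / 2
-- excess4 p x = 4 e(x) = 4 * overlap - p;  sumExcess4 = Σ over the list
ovl : ℕ → ℕ → ℕ
ovl zero    x = 0
ovl (suc q) x =
  length (filter (λ a → 2 * ((a * x) % suc q) <? suc q)
                 (applyUpTo suc (((suc q + 1) / 2) ∸ 1)))

excess4 : ℕ → ℕ → ℤ
excess4 p x = + (4 * ovl p x) - + p

sumExcess4 : (p : ℕ) → List (Fin p) → ℤ
sumExcess4 p []       = + 0
sumExcess4 p (x ∷ xs) = excess4 p (toℕ x) +ℤ sumExcess4 p xs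

{-# OPTIONS --safe #-}

-- Let s be the square wave modulo p, s y = (-1)^⌊2y/p⌋. Then 4 e(x) = Σ_{a<p} s(a) s(ax) - 2 for x ≠ 0.
-- By Dirichlet's theorem x ≡ u/v mod p with u, v coprime, 1 ≤ v ≤ n and |u| ≤ p/n; substituting a = vb turns the sum,
-- up to O(1), into ± Σ_b s(ub) s(vb). This samples the product of two square waves of frequencies u and v, whose mean is at most
-- 1/(|u|v) in absolute value (by the Chinese remainder theorem) and which changes sign O(|u| + v) times, so
-- 4 e(x) ≤ p/(|u|v) + O(|u| + v). The errors sum to O(p) because n² ≤ p, and since distinct x have distinct
-- fractions u/v, the main terms sum to at most 2 p Σ_v 1/v Σ_u 1/u = O(p (log p)²).
module Submission where

open import Defs
open import Data.Nat using (ℕ; _+_; _*_; _^_; _≤_)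
open import Data.Nat.Primality using (Prime)
open import Data.Nat.Logarithm using (⌊log₂_⌋)
open import Data.Fin using (Fin)
open import Data.List using (List; length)
open import Data.List.Relation.Unary.Unique.Propositional using (Unique)
open import Data.Integer using (+_) renaming (_≤_ to _≤ℤ_)
open import Data.Product using (∃-syntax; _×_)
open import Relation.Binary.PropositionalEquality using (_≡_)

open import Data.Nat using (zero; suc; NonZero; _<_; _<?_; _/_; _%_; _∸_; z≤n; s≤s; s<s; z<s; >-nonZero; ≢-nonZero)
open import Data.Nat.Logarithm using (⌊log₂[2^n]⌋≡n; ⌊log₂⌋-mono-≤)
open import Data.Nat.Properties as ℕ using ()
open import Data.Nat.DivMod
open import Data.Nat.Divisibility as ℕ∣ using (_∣_)
open import Data.Nat.GCD using (gcd; gcd[m,n]∣m; gcd[m,n]∣n; gcd[m,n]≢0)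
open import Data.Nat.Coprimality using (Coprime; coprime-divisor; coprime-/gcd; prime⇒coprime)
open import Data.Nat.Primality using (euclidsLemma; prime⇒nonZero)
open import Data.Nat.Tactic.RingSolver using () renaming (solve-∀ to ℕ-ring)
open import Data.Integer using (ℤ; -[1+_]; ∣_∣; +≤+; -≤+; -_; _-_) renaming (_+_ to _+ℤ_; _*_ to _*ℤ_)
open import Data.Integer.Properties as ℤ using ()
open import Data.Integer.Divisibility.Signed as ℤ∣ using (divides) renaming (_∣_ to _∣ℤ_)
open import Data.Integer.Tactic.RingSolver using () renaming (solve-∀ to ℤ-ring)
open import Data.Fin using (toℕ; fromℕ<)
open import Data.Fin.Properties using (toℕ-injective; toℕ-fromℕ<; toℕ<n; pigeonhole)
open import Data.List using ([]; _∷_; _++_; map; foldr; filter; upTo; applyUpTo; cartesianProduct)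
open import Data.List.Properties using (map-++; map-∘; map-upTo; map-applyUpTo; length-applyUpTo; ++-identityʳ; length-upTo; length-++; length-filter)
open import Data.List.Membership.Propositional using (_∈_)
open import Data.List.Membership.Propositional.Properties using (∈-∃++; ∈-map⁺; ∈-map⁻; ∈-upTo⁺; ∈-upTo⁻; ∈-++⁺ˡ; ∈-++⁺ʳ; ∈-cartesianProduct⁺)
open import Data.List.Relation.Unary.All as All using ()
open import Data.List.Relation.Unary.AllPairs using ([]; _∷_)
open import Data.List.Relation.Unary.Any using (here; there)
open import Data.List.Relation.Unary.Unique.Propositional.Properties using (map⁺; applyUpTo⁺₁)
open import Data.List.Relation.Binary.Permutation.Propositional using (_↭_; ↭-trans; ↭-prep; ↭-refl; ↭⇒↭ₛ)
open import Data.List.Relation.Binary.Permutation.Propositional.Properties using (shift; ∈-resp-↭; ↭-length) renaming (map⁺ to ↭-map⁺)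
open import Data.List.Relation.Binary.Permutation.Setoid.Properties using (foldr-commMonoid)
open import Data.Product using (_,_; proj₁; proj₂; ∃₂)
open import Data.Sum using (_⊎_; inj₁; inj₂)
open import Data.Empty using (⊥-elim)
open import Function using (_∘_)
open import Relation.Nullary using (¬_; yes; no)
open import Relation.Unary using (Decidable)
open import Relation.Binary.PropositionalEquality using (refl; sym; trans; cong; cong₂; subst; subst₂; _≢_; setoid; module ≡-Reasoning)

-- Finite sums of integers

-- The obstacle is that `a * x` jumps around modulo `p`, so its half of the period cannot be
-- followed as `a` varies. After the substitution both factors oscillate slowly: the number of sign
-- changes passed so far is a monotone step function that rises by `2 * (u + v)` over the period.
-- Samples of a sign governed by such a function differ from its average by at most a constant times
-- the total rise, wherever the sample points fall.
--
-- The comparison stays in the integers. On a common grid of `p * (2 * (u * v))` points the samples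
-- are the multiples of `2 * (u * v)`, while the sign is constant on blocks of length `p`. What
-- remains is a sum of `2 * (u * v)` signs, and this is at most 2 in absolute value.
--
-- Parity is what lets the Chinese remainder theorem in. For odd `u` the sign of `j / u` is that of
-- `j` times that of `j % u`, so for two odd frequencies the sign of `j` cancels and only residues
-- are left. For frequencies of opposite parity the two half periods cancel.

sumℤ : List ℤ → ℤ
sumℤ = foldr _+ℤ_ (+ 0)

Σ< : ℕ → (ℕ → ℤ) → ℤ
Σ< n f = sumℤ (applyUpTo f n)

sumℤ-++ : ∀ xs ys → sumℤ (xs ++ ys) ≡ sumℤ xs +ℤ sumℤ ys
sumℤ-++ []       ys = sym (ℤ.+-identityˡ _)
sumℤ-++ (x ∷ xs) ys = trans (cong (x +ℤ_) (sumℤ-++ xs ys)) (sym (ℤ.+-assoc x _ _))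

sumℤ-↭ : ∀ {xs ys} → xs ↭ ys → sumℤ xs ≡ sumℤ ys
sumℤ-↭ σ = foldr-commMonoid (setoid ℤ) ℤ.+-0-isCommutativeMonoid (↭⇒↭ₛ σ)

sumℤ-map-nonneg : ∀ {a} {A : Set a} (w : A → ℤ) → (∀ x → + 0 ≤ℤ w x) → ∀ xs → + 0 ≤ℤ sumℤ (map w xs)
sumℤ-map-nonneg w w≥0 []       = ℤ.≤-refl
sumℤ-map-nonneg w w≥0 (x ∷ xs) = ℤ.+-mono-≤ (w≥0 x) (sumℤ-map-nonneg w w≥0 xs)

Σ-cong : ∀ n {f g} → (∀ i → i < n → f i ≡ g i) → Σ< n f ≡ Σ< n g
Σ-cong zero    f≗g = refl
Σ-cong (suc n) f≗g = cong₂ _+ℤ_ (f≗g 0 z<s) (Σ-cong n (λ i i<n → f≗g (suc i) (s<s i<n)))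

Σ-mono : ∀ n {f g} → (∀ i → i < n → f i ≤ℤ g i) → Σ< n f ≤ℤ Σ< n g
Σ-mono zero    f≤g = ℤ.≤-refl
Σ-mono (suc n) f≤g = ℤ.+-mono-≤ (f≤g 0 z<s) (Σ-mono n (λ i i<n → f≤g (suc i) (s<s i<n)))

Σ-+ : ∀ n f g → Σ< n (λ i → f i +ℤ g i) ≡ Σ< n f +ℤ Σ< n g
Σ-+ zero    f g = refl
Σ-+ (suc n) f g = trans (cong (f 0 +ℤ g 0 +ℤ_) (Σ-+ n (f ∘ suc) (g ∘ suc))) (interchange (f 0) (g 0) _ _)
  where
  interchange : ∀ a b c d → (a +ℤ b) +ℤ (c +ℤ d) ≡ (a +ℤ c) +ℤ (b +ℤ d)
  interchange = ℤ-ring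

Σ-*ˡ : ∀ n c f → Σ< n (λ i → c *ℤ f i) ≡ c *ℤ Σ< n f
Σ-*ˡ zero    c f = sym (ℤ.*-zeroʳ c)
Σ-*ˡ (suc n) c f = trans (cong (c *ℤ f 0 +ℤ_) (Σ-*ˡ n c (f ∘ suc))) (sym (ℤ.*-distribˡ-+ c _ _))

Σ-*ʳ : ∀ n c f → Σ< n (λ i → f i *ℤ c) ≡ Σ< n f *ℤ c
Σ-*ʳ n c f = trans (Σ-cong n (λ i _ → ℤ.*-comm (f i) c)) (trans (Σ-*ˡ n c f) (ℤ.*-comm c _))

Σ-neg : ∀ n f → Σ< n (λ i → - f i) ≡ - Σ< n f
Σ-neg zero    f = refl
Σ-neg (suc n) f = trans (cong (- f 0 +ℤ_) (Σ-neg n (f ∘ suc))) (sym (ℤ.neg-distrib-+ (f 0) _))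

Σ-const : ∀ n c → Σ< n (λ _ → c) ≡ + n *ℤ c
Σ-const zero    c = sym (ℤ.*-zeroˡ c)
Σ-const (suc n) c = trans (cong (c +ℤ_) (Σ-const n c)) (sym (ℤ.suc-* (+ n) c))

Σ-split : ∀ m n f → Σ< (m + n) f ≡ Σ< m f +ℤ Σ< n (λ i → f (m + i))
Σ-split zero    n f = sym (ℤ.+-identityˡ _)
Σ-split (suc m) n f = trans (cong (f 0 +ℤ_) (Σ-split m n (f ∘ suc))) (sym (ℤ.+-assoc (f 0) _ _))

Σ-last : ∀ n f → Σ< (suc n) f ≡ Σ< n f +ℤ f n
Σ-last zero    f = ℤ.+-comm (f 0) (+ 0)
Σ-last (suc n) f = trans (cong (f 0 +ℤ_) (Σ-last n (f ∘ suc))) (sym (ℤ.+-assoc (f 0) _ _))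

Σ-reverse : ∀ n f → Σ< n f ≡ Σ< n (λ i → f (n ∸ suc i))
Σ-reverse zero    f = refl
Σ-reverse (suc n) f = begin
  Σ< (suc n) f                          ≡⟨ Σ-last n f ⟩
  Σ< n f +ℤ f n                         ≡⟨ ℤ.+-comm _ (f n) ⟩
  f n +ℤ Σ< n f                         ≡⟨ cong (f n +ℤ_) (Σ-reverse n f) ⟩
  f n +ℤ Σ< n (λ i → f (n ∸ suc i))     ∎
  where open ≡-Reasoning

Σ-block : ∀ m n f → Σ< (m * n) f ≡ Σ< m (λ k → Σ< n (λ r → f (k * n + r)))
Σ-block zero    n f = refl
Σ-block (suc m) n f = begin
  Σ< (n + m * n) f                                                   ≡⟨ Σ-split n (m * n) f ⟩
  Σ< n f +ℤ Σ< (m * n) (λ i → f (n + i))                             ≡⟨ cong (Σ< n f +ℤ_) (Σ-block m n (λ i → f (n + i))) ⟩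
  Σ< n f +ℤ Σ< m (λ k → Σ< n (λ r → f (n + (k * n + r))))            ≡⟨ cong (Σ< n f +ℤ_) (Σ-cong m λ k _ → Σ-cong n λ r _ → cong f (sym (ℕ.+-assoc n (k * n) r))) ⟩
  Σ< n f +ℤ Σ< m (λ k → Σ< n (λ r → f (suc k * n + r)))              ∎
  where open ≡-Reasoning

Σ-zero : ∀ n → Σ< n (λ _ → + 0) ≡ + 0
Σ-zero n = trans (Σ-const n (+ 0)) (ℤ.*-zeroʳ (+ n))

Σ-swap : ∀ m n (f : ℕ → ℕ → ℤ) → Σ< m (λ i → Σ< n (f i)) ≡ Σ< n (λ j → Σ< m (λ i → f i j))
Σ-swap zero    n f = sym (Σ-zero n)
Σ-swap (suc m) n f = trans (cong (Σ< n (f 0) +ℤ_) (Σ-swap m n (f ∘ suc))) (sym (Σ-+ n (f 0) _))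

Σ-telescope : ∀ n (f : ℕ → ℤ) → Σ< n (λ i → f (suc i) - f i) ≡ f n - f 0
Σ-telescope zero    f = sym (ℤ.+-inverseʳ (f 0))
Σ-telescope (suc n) f = trans (cong (f 1 - f 0 +ℤ_) (Σ-telescope n (f ∘ suc))) (chain (f 0) (f 1) (f (suc n)))
  where
  chain : ∀ a b c → (b - a) +ℤ (c - b) ≡ c - a
  chain = ℤ-ring

-- The complement `zs` is kept explicit because it has two uses: nonnegative weights on it give an
-- inequality of sums, and a count of lengths can force it to be empty.
unique-⊆⇒↭ : ∀ {a} {A : Set a} {xs ys : List A} → Unique xs → (∀ {x} → x ∈ xs → x ∈ ys) →
             ∃[ zs ] (ys ↭ xs ++ zs)
unique-⊆⇒↭ {xs = []}     {ys} _ _ = ys , ↭-refl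
unique-⊆⇒↭ {xs = x ∷ xs} {ys} (x∉xs ∷ uniq) sub with ∈-∃++ (sub (here refl))
... | as , bs , refl = let zs , σ = unique-⊆⇒↭ uniq sub′ in zs , ↭-trans (shift x as bs) (↭-prep x σ)
  where
  sub′ : ∀ {y} → y ∈ xs → y ∈ as ++ bs
  sub′ y∈xs with ∈-resp-↭ (shift x as bs) (sub (there y∈xs))
  ... | here refl = ⊥-elim (All.lookup x∉xs y∈xs refl)
  ... | there y∈  = y∈

sumℤ-map-⊆ : ∀ {a} {A : Set a} (w : A → ℤ) → (∀ x → + 0 ≤ℤ w x) → ∀ {xs ys} → Unique xs →
             (∀ {x} → x ∈ xs → x ∈ ys) → sumℤ (map w xs) ≤ℤ sumℤ (map w ys)
sumℤ-map-⊆ w w≥0 {xs} {ys} uniq sub with zs , σ ← unique-⊆⇒↭ uniq sub = begin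
  sumℤ (map w xs)                         ≡⟨ ℤ.+-identityʳ _ ⟨
  sumℤ (map w xs) +ℤ + 0                  ≤⟨ ℤ.+-monoʳ-≤ (sumℤ (map w xs)) (sumℤ-map-nonneg w w≥0 zs) ⟩
  sumℤ (map w xs) +ℤ sumℤ (map w zs)      ≡⟨ sumℤ-++ (map w xs) (map w zs) ⟨
  sumℤ (map w xs ++ map w zs)             ≡⟨ cong sumℤ (map-++ w xs zs) ⟨
  sumℤ (map w (xs ++ zs))                 ≡⟨ sumℤ-↭ (↭-map⁺ w σ) ⟨
  sumℤ (map w ys)                         ∎
  where open ℤ.≤-Reasoning

-- The values of an injective self-map form a duplicate-free list inside `upTo m`. Both lists have
-- length `m`, so the complement is empty and one is a rearrangement of the other.
Σ-permute : ∀ m (π : ℕ → ℕ) → (∀ i → i < m → π i < m) →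
            (∀ {i j} → i < j → j < m → π i ≢ π j) → ∀ g → Σ< m (g ∘ π) ≡ Σ< m g
Σ-permute m π bounded inj g with unique-⊆⇒↭ {xs = applyUpTo π m} {ys = upTo m} (applyUpTo⁺₁ π m inj) sub
  where
  sub : ∀ {x} → x ∈ applyUpTo π m → x ∈ upTo m
  sub x∈ with i , i∈ , refl ← ∈-map⁻ π (subst (_ ∈_) (sym (map-upTo π m)) x∈) = ∈-upTo⁺ (bounded i (∈-upTo⁻ i∈))
... | z ∷ zs , σ = ⊥-elim (ℕ.m≢1+m+n m (begin
    m                                           ≡⟨ length-upTo m ⟨
    length (upTo m)                             ≡⟨ ↭-length σ ⟩
    length (applyUpTo π m ++ z ∷ zs)            ≡⟨ length-++ (applyUpTo π m) ⟩
    length (applyUpTo π m) + suc (length zs)    ≡⟨ cong (_+ _) (length-applyUpTo π m) ⟩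
    m + suc (length zs)                         ≡⟨ ℕ.+-suc m _ ⟩
    suc (m + length zs)                         ∎))
  where open ≡-Reasoning
... | [] , σ = begin
  Σ< m (g ∘ π)                                  ≡⟨ cong sumℤ (map-applyUpTo π g m) ⟨
  sumℤ (map g (applyUpTo π m))                  ≡⟨ cong (sumℤ ∘ map g) (++-identityʳ (applyUpTo π m)) ⟨
  sumℤ (map g (applyUpTo π m ++ []))            ≡⟨ sumℤ-↭ (↭-map⁺ g σ) ⟨
  sumℤ (map g (upTo m))                         ≡⟨ cong sumℤ (map-upTo g m) ⟩
  Σ< m g                                        ∎
  where open ≡-Reasoning

-- Signs

sgn : ℕ → ℤ
sgn zero    = + 1
sgn (suc k) = - sgn k

sgn-+ : ∀ a b → sgn (a + b) ≡ sgn a *ℤ sgn b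
sgn-+ zero    b = sym (ℤ.*-identityˡ _)
sgn-+ (suc a) b = trans (cong -_ (sgn-+ a b)) (ℤ.neg-distribˡ-* (sgn a) (sgn b))

sgn-cases : ∀ a → sgn a ≡ + 1 ⊎ sgn a ≡ -[1+ 0 ]
sgn-cases zero = inj₁ refl
sgn-cases (suc a) with sgn-cases a
... | inj₁ eq = inj₂ (cong -_ eq)
... | inj₂ eq = inj₁ (cong -_ eq)

sgn-square : ∀ a → sgn a *ℤ sgn a ≡ + 1
sgn-square a with sgn a | sgn-cases a
... | _ | inj₁ refl = refl
... | _ | inj₂ refl = refl

sgn-double : ∀ a → sgn (2 * a) ≡ + 1
sgn-double a = begin
  sgn (a + (a + 0))   ≡⟨ cong (λ b → sgn (a + b)) (ℕ.+-identityʳ a) ⟩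
  sgn (a + a)         ≡⟨ sgn-+ a a ⟩
  sgn a *ℤ sgn a      ≡⟨ sgn-square a ⟩
  + 1                 ∎
  where open ≡-Reasoning

sgn-*-odd : ∀ q u → sgn u ≡ -[1+ 0 ] → sgn (q * u) ≡ sgn q
sgn-*-odd zero    u odd = refl
sgn-*-odd (suc q) u odd = begin
  sgn (u + q * u)            ≡⟨ sgn-+ u (q * u) ⟩
  sgn u *ℤ sgn (q * u)       ≡⟨ cong₂ _*ℤ_ odd (sgn-*-odd q u odd) ⟩
  -[1+ 0 ] *ℤ sgn q          ≡⟨ ℤ.-1*i≡-i (sgn q) ⟩
  - sgn q                    ∎
  where open ≡-Reasoning

sgn≡1⇒2∣ : ∀ a → sgn a ≡ + 1 → 2 ∣ a
sgn≡1⇒2∣ zero          _  = 2 ℕ∣.∣0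
sgn≡1⇒2∣ (suc (suc a)) eq = ℕ∣.∣m∣n⇒∣m+n ℕ∣.∣-refl (sgn≡1⇒2∣ a (trans (sym (ℤ.neg-involutive (sgn a))) eq))

Σ-sgn-cases : ∀ n → Σ< n sgn ≡ + 0 ⊎ Σ< n sgn ≡ + 1
Σ-sgn-cases zero = inj₁ refl
Σ-sgn-cases (suc n) with Σ-sgn-cases n
... | inj₁ eq = inj₂ (trans (cong (+ 1 +ℤ_) (Σ-neg n sgn)) (cong (λ i → + 1 - i) eq))
... | inj₂ eq = inj₁ (trans (cong (+ 1 +ℤ_) (Σ-neg n sgn)) (cong (λ i → + 1 - i) eq))

-- Two-sided bounds

infix 4 _±≤_

-- Stands for an absolute value bound, as a pair of inequalities that add up without leaving the
-- integers. Both halves are eventually used, since a negative `u` reverses the sign of the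
-- correlation.
_±≤_ : ℤ → ℤ → Set
i ±≤ b = (i ≤ℤ b) × (- i ≤ℤ b)

±≤-+ : ∀ {i j b c} → i ±≤ b → j ±≤ c → (i +ℤ j) ±≤ (b +ℤ c)
±≤-+ {i} {j} (p , q) (r , s) =
  ℤ.+-mono-≤ p r , subst (_≤ℤ _) (sym (ℤ.neg-distrib-+ i j)) (ℤ.+-mono-≤ q s)

±≤-trans : ∀ {i b c} → i ±≤ b → b ≤ℤ c → i ±≤ c
±≤-trans (p , q) b≤c = ℤ.≤-trans p b≤c , ℤ.≤-trans q b≤c

Σ-±≤ : ∀ n {f g} → (∀ i → i < n → f i ±≤ g i) → Σ< n f ±≤ Σ< n g
Σ-±≤ zero    f±≤g = ℤ.≤-refl , ℤ.≤-refl
Σ-±≤ (suc n) f±≤g = ±≤-+ (f±≤g 0 z<s) (Σ-±≤ n (λ i i<n → f±≤g (suc i) (s<s i<n)))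

sgn-lipschitz : ∀ a k → (sgn a - sgn (k + a)) ±≤ + (2 * k)
sgn-lipschitz a zero rewrite ℤ.+-inverseʳ (sgn a) = ℤ.≤-refl , ℤ.≤-refl
sgn-lipschitz a (suc k) =
  subst₂ _±≤_ (sym (rearrange (sgn a) (sgn (k + a)))) (cong +_ (trans (ℕ.+-comm (2 * k) 2) (sym (ℕ.*-suc 2 k))))
    (±≤-+ (sgn-lipschitz a k) (double (k + a)))
  where
  rearrange : ∀ x y → x - - y ≡ (x - y) +ℤ (+ 2 *ℤ y)
  rearrange = ℤ-ring

  double : ∀ b → (+ 2 *ℤ sgn b) ±≤ + 2
  double b with sgn b | sgn-cases b
  ... | _ | inj₁ refl = ℤ.≤-refl , -≤+
  ... | _ | inj₂ refl = -≤+ , ℤ.≤-refl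

-- Bounding by the far end `c` instead of `b` gives all refined points of one block the same bound,
-- namely the rise across the block, which then telescopes over the blocks.
sgn-variation : ∀ {a b c} → a ≤ b → b ≤ c → (sgn a - sgn b) ±≤ (+ 2 *ℤ (+ c - + a))
sgn-variation {a} {b} {c} a≤b b≤c =
  ±≤-trans (subst (λ x → (sgn a - sgn x) ±≤ + (2 * (b ∸ a))) (ℕ.m∸n+n≡m a≤b) (sgn-lipschitz a (b ∸ a)))
    (begin
      + (2 * (b ∸ a))            ≡⟨ ℤ.pos-* 2 (b ∸ a) ⟩
      + 2 *ℤ + (b ∸ a)           ≡⟨ cong (+ 2 *ℤ_) (trans (sym (ℤ.⊖-≥ a≤b)) (sym (ℤ.m-n≡m⊖n b a))) ⟩
      + 2 *ℤ (+ b - + a)         ≤⟨ ℤ.*-monoˡ-≤-nonNeg (+ 2) (ℤ.+-monoˡ-≤ (- + a) (+≤+ b≤c)) ⟩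
      + 2 *ℤ (+ c - + a)         ∎)
  where open ℤ.≤-Reasoning

-- Refining the sample points b M by M shifts each: the total error telescopes because a is monotone.
sgn-refinement : ∀ (a : ℕ → ℕ) → (∀ {i j} → i ≤ j → a i ≤ a j) → ∀ M p →
                 (+ M *ℤ Σ< p (λ b → sgn (a (b * M))) - Σ< (p * M) (sgn ∘ a)) ±≤
                 (+ M *ℤ (+ 2 *ℤ (+ a (p * M) - + a 0)))
sgn-refinement a mono M p = subst₂ _±≤_ left right
  (Σ-±≤ p λ b _ → Σ-±≤ M λ t t<M →
    sgn-variation (mono (ℕ.m≤m+n (b * M) t))
                  (mono (ℕ.≤-trans (ℕ.+-monoʳ-≤ (b * M) (ℕ.<⇒≤ t<M)) (ℕ.≤-reflexive (ℕ.+-comm (b * M) M)))))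
  where
  open ≡-Reasoning

  fine : ℕ → ℕ → ℤ
  fine b t = sgn (a (b * M + t))

  coarse : ℕ → ℤ
  coarse b = sgn (a (b * M))

  left : Σ< p (λ b → Σ< M (λ t → coarse b - fine b t)) ≡ + M *ℤ Σ< p coarse - Σ< (p * M) (sgn ∘ a)
  left = begin
    Σ< p (λ b → Σ< M (λ t → coarse b - fine b t))                ≡⟨ Σ-cong p (λ b _ → Σ-+ M (λ _ → coarse b) (λ t → - fine b t)) ⟩
    Σ< p (λ b → Σ< M (λ _ → coarse b) +ℤ Σ< M (λ t → - fine b t))
                                                                 ≡⟨ Σ-cong p (λ b _ → cong₂ _+ℤ_ (Σ-const M (coarse b)) (Σ-neg M (fine b))) ⟩
    Σ< p (λ b → + M *ℤ coarse b - Σ< M (fine b))                 ≡⟨ Σ-+ p (λ b → + M *ℤ coarse b) (λ b → - Σ< M (fine b)) ⟩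
    Σ< p (λ b → + M *ℤ coarse b) +ℤ Σ< p (λ b → - Σ< M (fine b)) ≡⟨ cong₂ _+ℤ_ (Σ-*ˡ p (+ M) coarse) (Σ-neg p (λ b → Σ< M (fine b))) ⟩
    + M *ℤ Σ< p coarse - Σ< p (λ b → Σ< M (fine b))              ≡⟨ cong (λ x → + M *ℤ Σ< p coarse - x) (sym (Σ-block p M (sgn ∘ a))) ⟩
    + M *ℤ Σ< p coarse - Σ< (p * M) (sgn ∘ a)                    ∎

  A : ℕ → ℤ
  A b = + a (b * M)

  right : Σ< p (λ b → Σ< M (λ _ → + 2 *ℤ (A (suc b) - A b))) ≡ + M *ℤ (+ 2 *ℤ (A p - A 0))
  right = begin
    Σ< p (λ b → Σ< M (λ _ → + 2 *ℤ (A (suc b) - A b)))   ≡⟨ Σ-cong p (λ b _ → Σ-const M (+ 2 *ℤ (A (suc b) - A b))) ⟩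
    Σ< p (λ b → + M *ℤ (+ 2 *ℤ (A (suc b) - A b)))       ≡⟨ Σ-*ˡ p (+ M) (λ b → + 2 *ℤ (A (suc b) - A b)) ⟩
    + M *ℤ Σ< p (λ b → + 2 *ℤ (A (suc b) - A b))         ≡⟨ cong (+ M *ℤ_) (Σ-*ˡ p (+ 2) (λ b → A (suc b) - A b)) ⟩
    + M *ℤ (+ 2 *ℤ Σ< p (λ b → A (suc b) - A b))         ≡⟨ cong (λ x → + M *ℤ (+ 2 *ℤ x)) (Σ-telescope p A) ⟩
    + M *ℤ (+ 2 *ℤ (A p - A 0))                          ∎

-- Correlation of two square waves of coprime frequencies

%≡⇒∣∸ : ∀ m a b .{{_ : NonZero m}} → a % m ≡ b % m → m ∣ b ∸ a
%≡⇒∣∸ m a b eq = ℕ∣.divides (b / m ∸ a / m) (begin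
  b ∸ a                                               ≡⟨ cong₂ _∸_ (m≡m%n+[m/n]*n b m) (m≡m%n+[m/n]*n a m) ⟩
  (b % m + b / m * m) ∸ (a % m + a / m * m)           ≡⟨ cong (λ r → (b % m + b / m * m) ∸ (r + a / m * m)) eq ⟩
  (b % m + b / m * m) ∸ (b % m + a / m * m)           ≡⟨ ℕ.[m+n]∸[m+o]≡n∸o (b % m) _ _ ⟩
  b / m * m ∸ a / m * m                               ≡⟨ ℕ.*-distribʳ-∸ m (b / m) (a / m) ⟨
  (b / m ∸ a / m) * m                                 ∎)
  where open ≡-Reasoning

-- A collision at `i < j` would make `m` divide `u * (j ∸ i)`, hence the positive number `j ∸ i`
-- below `m`. The offset `r` serves the Chinese remainder theorem; the dilation by `v` takes `r` to
-- be 0.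
Σ-affine : ∀ m u r .{{_ : NonZero m}} → Coprime m u → ∀ g → Σ< m (λ k → g ((k * u + r) % m)) ≡ Σ< m g
Σ-affine m u r m⊥u g = Σ-permute m (λ k → (k * u + r) % m) (λ k _ → m%n<n (k * u + r) m) inj g
  where
  difference : ∀ i j → (j * u + r) ∸ (i * u + r) ≡ u * (j ∸ i)
  difference i j = begin
    (j * u + r) ∸ (i * u + r)   ≡⟨ cong₂ _∸_ (ℕ.+-comm (j * u) r) (ℕ.+-comm (i * u) r) ⟩
    (r + j * u) ∸ (r + i * u)   ≡⟨ ℕ.[m+n]∸[m+o]≡n∸o r (j * u) (i * u) ⟩
    j * u ∸ i * u               ≡⟨ ℕ.*-distribʳ-∸ u j i ⟨
    (j ∸ i) * u                 ≡⟨ ℕ.*-comm (j ∸ i) u ⟩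
    u * (j ∸ i)                 ∎
    where open ≡-Reasoning

  inj : ∀ {i j} → i < j → j < m → (i * u + r) % m ≢ (j * u + r) % m
  inj {i} {j} i<j j<m eq =
    ℕ∣.>⇒∤ {{>-nonZero (ℕ.m<n⇒0<n∸m i<j)}} (ℕ.≤-<-trans (ℕ.m∸n≤m j i) j<m)
      (coprime-divisor m⊥u (subst (m ∣_) (difference i j) (%≡⇒∣∸ m (i * u + r) (j * u + r) eq)))

-- In `j = j % u + (j / u) * u` an odd `u` does not affect the parity of the last product, so the
-- parity of the quotient can be read off from `j` and its residue.
sgn-quotient-odd : ∀ j u .{{_ : NonZero u}} → sgn u ≡ -[1+ 0 ] → sgn (j / u) ≡ sgn j *ℤ sgn (j % u)
sgn-quotient-odd j u odd = begin
  sgn (j / u)                                          ≡⟨ ℤ.*-identityˡ _ ⟨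
  + 1 *ℤ sgn (j / u)                                   ≡⟨ cong (_*ℤ sgn (j / u)) (sgn-square (j % u)) ⟨
  (sgn (j % u) *ℤ sgn (j % u)) *ℤ sgn (j / u)          ≡⟨ regroup (sgn (j % u)) (sgn (j / u)) ⟩
  (sgn (j % u) *ℤ sgn (j / u)) *ℤ sgn (j % u)          ≡⟨ cong (λ x → (sgn (j % u) *ℤ x) *ℤ sgn (j % u)) (sgn-*-odd (j / u) u odd) ⟨
  (sgn (j % u) *ℤ sgn (j / u * u)) *ℤ sgn (j % u)      ≡⟨ cong (_*ℤ sgn (j % u)) (sgn-+ (j % u) (j / u * u)) ⟨
  sgn (j % u + j / u * u) *ℤ sgn (j % u)               ≡⟨ cong (λ x → sgn x *ℤ sgn (j % u)) (m≡m%n+[m/n]*n j u) ⟨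
  sgn j *ℤ sgn (j % u)                                 ∎
  where
  open ≡-Reasoning
  regroup : ∀ x y → (x *ℤ x) *ℤ y ≡ (x *ℤ y) *ℤ x
  regroup = ℤ-ring

module _ (u v : ℕ) .{{_ : NonZero u}} .{{_ : NonZero v}} (v⊥u : Coprime v u) where

  private
    -- Cut the period into `2 * (u * v)` equal cells. The product of the two square waves is
    -- constant on each, and this is its value on cell `j`: the wave of frequency `u` has changed
    -- sign `j / v` times by then, the other one `j / u` times.
    wave : ℕ → ℤ
    wave j = sgn (j / u + j / v)

    instance
      uv≢0 : NonZero (u * v)
      uv≢0 = ℕ.m*n≢0 u v

  -- The shift is a multiple of both `u` and `v`, so the quotients grow by exactly `v` and `u`. When
  -- one frequency is even and the other odd, the two half periods therefore cancel.
  wave-antiperiodic : ∀ j → wave (u * v + j) ≡ (sgn u *ℤ sgn v) *ℤ wave j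
  wave-antiperiodic j = begin
    sgn ((u * v + j) / u + (u * v + j) / v)       ≡⟨ cong₂ (λ x y → sgn (x + y)) shift-u shift-v ⟩
    sgn ((v + j / u) + (u + j / v))               ≡⟨ cong sgn (regroup (j / u) (j / v) u v) ⟩
    sgn (u + v + (j / u + j / v))                 ≡⟨ sgn-+ (u + v) (j / u + j / v) ⟩
    sgn (u + v) *ℤ wave j                         ≡⟨ cong (_*ℤ wave j) (sgn-+ u v) ⟩
    (sgn u *ℤ sgn v) *ℤ wave j                    ∎
    where
    open ≡-Reasoning
    regroup : ∀ x y u v → (v + x) + (u + y) ≡ u + v + (x + y)
    regroup = ℕ-ring

    shift-u : (u * v + j) / u ≡ v + j / u
    shift-u = trans (+-distrib-/-∣ˡ j (ℕ∣.m∣m*n v))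
                    (cong (_+ j / u) (trans (cong (_/ u) (ℕ.*-comm u v)) (m*n/n≡m v u)))

    shift-v : (u * v + j) / v ≡ u + j / v
    shift-v = trans (+-distrib-/-∣ˡ j (ℕ∣.n∣m*n u)) (cong (_+ j / v) (m*n/n≡m u v))

  -- By the Chinese remainder theorem the sum over a half period factors.
  Σ-wave-odd : sgn u ≡ -[1+ 0 ] → sgn v ≡ -[1+ 0 ] → Σ< (u * v) wave ≡ Σ< u sgn *ℤ Σ< v sgn
  Σ-wave-odd u-odd v-odd = begin
    Σ< (u * v) wave                                                       ≡⟨ cong (λ m → Σ< m wave) (ℕ.*-comm u v) ⟩
    Σ< (v * u) wave                                                       ≡⟨ Σ-block v u wave ⟩
    Σ< v (λ k → Σ< u (λ r → wave (k * u + r)))                            ≡⟨ Σ-cong v (λ k _ → Σ-cong u (λ r r<u → factor k r r<u)) ⟩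
    Σ< v (λ k → Σ< u (λ r → sgn r *ℤ sgn ((k * u + r) % v)))              ≡⟨ Σ-swap v u (λ k r → sgn r *ℤ sgn ((k * u + r) % v)) ⟩
    Σ< u (λ r → Σ< v (λ k → sgn r *ℤ sgn ((k * u + r) % v)))              ≡⟨ Σ-cong u (λ r _ → Σ-*ˡ v (sgn r) (λ k → sgn ((k * u + r) % v))) ⟩
    -- The Chinese remainder step: among the numbers with a fixed residue `r` modulo `u`, every
    -- residue modulo `v` occurs exactly once.
    Σ< u (λ r → sgn r *ℤ Σ< v (λ k → sgn ((k * u + r) % v)))              ≡⟨ Σ-cong u (λ r _ → cong (sgn r *ℤ_) (Σ-affine v u r v⊥u sgn)) ⟩
    Σ< u (λ r → sgn r *ℤ Σ< v sgn)                                        ≡⟨ Σ-*ʳ u (Σ< v sgn) sgn ⟩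
    Σ< u sgn *ℤ Σ< v sgn                                                  ∎
    where
    open ≡-Reasoning
    regroup : ∀ j x y → (j *ℤ x) *ℤ (j *ℤ y) ≡ (j *ℤ j) *ℤ (x *ℤ y)
    regroup = ℤ-ring

    factor : ∀ k r → r < u → wave (k * u + r) ≡ sgn r *ℤ sgn ((k * u + r) % v)
    factor k r r<u = begin
      sgn (j / u + j / v)                                        ≡⟨ sgn-+ (j / u) (j / v) ⟩
      sgn (j / u) *ℤ sgn (j / v)                                 ≡⟨ cong₂ _*ℤ_ (sgn-quotient-odd j u u-odd) (sgn-quotient-odd j v v-odd) ⟩
      -- Each odd quotient contributes one copy of `sgn j`; the two copies square to 1, and only the
      -- residues survive.
      (sgn j *ℤ sgn (j % u)) *ℤ (sgn j *ℤ sgn (j % v))           ≡⟨ regroup (sgn j) (sgn (j % u)) (sgn (j % v)) ⟩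
      (sgn j *ℤ sgn j) *ℤ (sgn (j % u) *ℤ sgn (j % v))           ≡⟨ cong (_*ℤ (sgn (j % u) *ℤ sgn (j % v))) (sgn-square j) ⟩
      + 1 *ℤ (sgn (j % u) *ℤ sgn (j % v))                        ≡⟨ ℤ.*-identityˡ _ ⟩
      sgn (j % u) *ℤ sgn (j % v)                                 ≡⟨ cong (λ x → sgn x *ℤ sgn (j % v)) remainder ⟩
      sgn r *ℤ sgn (j % v)                                       ∎
      where
      j = k * u + r
      remainder : j % u ≡ r
      remainder = trans (cong (_% u) (ℕ.+-comm (k * u) r)) (trans ([m+kn]%n≡m%n r k u) (m<n⇒m%n≡m r<u))

  -- Two even frequencies are excluded by coprimality. Opposite parities give 0. Two odd ones give
  -- equal half periods, each a product of alternating sums with values in {0, 1}, whence the bound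
  -- 2.
  Σ-wave : Σ< (2 * (u * v)) wave ±≤ + 2
  Σ-wave = subst (_±≤ + 2) (sym halves) (bound (sgn-cases u) (sgn-cases v))
    where
    T = Σ< (u * v) wave

    halves : Σ< (2 * (u * v)) wave ≡ T +ℤ (sgn u *ℤ sgn v) *ℤ T
    halves = begin
      Σ< (u * v + (u * v + 0)) wave                         ≡⟨ cong (λ m → Σ< (u * v + m) wave) (ℕ.+-identityʳ (u * v)) ⟩
      Σ< (u * v + u * v) wave                               ≡⟨ Σ-split (u * v) (u * v) wave ⟩
      T +ℤ Σ< (u * v) (λ j → wave (u * v + j))              ≡⟨ cong (T +ℤ_) (Σ-cong (u * v) (λ j _ → wave-antiperiodic j)) ⟩
      T +ℤ Σ< (u * v) (λ j → (sgn u *ℤ sgn v) *ℤ wave j)    ≡⟨ cong (T +ℤ_) (Σ-*ˡ (u * v) (sgn u *ℤ sgn v) wave) ⟩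
      T +ℤ (sgn u *ℤ sgn v) *ℤ T                            ∎
      where open ≡-Reasoning

    cancels : ∀ x → x +ℤ -[1+ 0 ] *ℤ x ≡ + 0
    cancels = ℤ-ring

    zero-bound : + 0 ±≤ + 2
    zero-bound = +≤+ z≤n , +≤+ z≤n

    bound : sgn u ≡ + 1 ⊎ sgn u ≡ -[1+ 0 ] → sgn v ≡ + 1 ⊎ sgn v ≡ -[1+ 0 ] →
            (T +ℤ (sgn u *ℤ sgn v) *ℤ T) ±≤ + 2
    bound (inj₁ u-even) (inj₁ v-even) with v⊥u (sgn≡1⇒2∣ v v-even , sgn≡1⇒2∣ u u-even)
    ... | ()
    bound (inj₁ u-even) (inj₂ v-odd) rewrite u-even | v-odd | cancels T = zero-bound
    bound (inj₂ u-odd) (inj₁ v-even) rewrite u-odd | v-even | cancels T = zero-bound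
    bound (inj₂ u-odd) (inj₂ v-odd) rewrite Σ-wave-odd u-odd v-odd | u-odd | v-odd
      with Σ< u sgn | Σ-sgn-cases u | Σ< v sgn | Σ-sgn-cases v
    ... | _ | inj₁ refl | _ | inj₁ refl = zero-bound
    ... | _ | inj₁ refl | _ | inj₂ refl = zero-bound
    ... | _ | inj₂ refl | _ | inj₁ refl = zero-bound
    ... | _ | inj₂ refl | _ | inj₂ refl = ℤ.≤-refl , -≤+

  -- The first summand comes from the mean of the product of waves, the second from replacing
  -- samples by averages. Multiplying by `u * v` avoids fractions.
  correlation-bound : ∀ p .{{_ : NonZero p}} →
    (+ (u * v) *ℤ Σ< p (λ b → sgn ((2 * (u * b)) / p + (2 * (v * b)) / p))) ±≤
    (+ p +ℤ + (4 * (u * v) * (u + v)))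
  correlation-bound p = halve (subst₂ _±≤_ combine total (±≤-+ refinement coarse-bound))
    where
    M = 2 * (u * v)
    D = Σ< p (λ b → sgn ((2 * (u * b)) / p + (2 * (v * b)) / p))

    instance
      pu≢0 : NonZero (p * u)
      pu≢0 = ℕ.m*n≢0 p u
      pv≢0 : NonZero (p * v)
      pv≢0 = ℕ.m*n≢0 p v

    -- Sign changes passed up to position `i` on the grid of `p * M` points. At multiples of `M`
    -- this is the exponent sampled in `D`; on the block of length `p` starting at `j * p` it is the
    -- constant exponent of `wave j`.
    a : ℕ → ℕ
    a i = i / (p * v) + i / (p * u)

    a-mono : ∀ {i j} → i ≤ j → a i ≤ a j
    a-mono i≤j = ℕ.+-mono-≤ (/-monoˡ-≤ (p * v) i≤j) (/-monoˡ-≤ (p * u) i≤j)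

    a-sample : ∀ b → a (b * M) ≡ (2 * (u * b)) / p + (2 * (v * b)) / p
    a-sample b = cong₂ _+_
      (trans (cong (_/ (p * v)) (eq₁ b u v)) (m*n/o*n≡m/o (2 * (u * b)) v p))
      (trans (cong (_/ (p * u)) (eq₂ b u v)) (m*n/o*n≡m/o (2 * (v * b)) u p))
      where
      eq₁ : ∀ b u v → b * (2 * (u * v)) ≡ 2 * (u * b) * v
      eq₁ = ℕ-ring
      eq₂ : ∀ b u v → b * (2 * (u * v)) ≡ 2 * (v * b) * u
      eq₂ = ℕ-ring

    a-end : a (p * M) ≡ 2 * (u + v)
    a-end = trans (cong₂ _+_ (trans (cong (_/ (p * v)) (eq₁ p u v)) (m*n/n≡m (2 * u) (p * v)))
                             (trans (cong (_/ (p * u)) (eq₂ p u v)) (m*n/n≡m (2 * v) (p * u))))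
                  (sym (ℕ.*-distribˡ-+ 2 u v))
      where
      eq₁ : ∀ p u v → p * (2 * (u * v)) ≡ (2 * u) * (p * v)
      eq₁ = ℕ-ring
      eq₂ : ∀ p u v → p * (2 * (u * v)) ≡ (2 * v) * (p * u)
      eq₂ = ℕ-ring

    a-start : a 0 ≡ 0
    a-start = cong₂ _+_ (0/n≡0 (p * v)) (0/n≡0 (p * u))

    a-block : ∀ j r → r < p → a (j * p + r) ≡ j / u + j / v
    a-block j r r<p = trans (ℕ.+-comm _ (i / (p * u))) (cong₂ _+_ (quotient u) (quotient v))
      where
      i = j * p + r
      quotient : ∀ w .{{_ : NonZero w}} .{{_ : NonZero (p * w)}} → i / (p * w) ≡ j / w
      quotient w = begin
        i / (p * w)                      ≡⟨ m/n/o≡m/[n*o] i p w ⟨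
        i / p / w                        ≡⟨ cong (_/ w) (+-distrib-/-∣ˡ r (ℕ∣.n∣m*n j)) ⟩
        (j * p / p + r / p) / w          ≡⟨ cong (_/ w) (cong₂ _+_ (m*n/n≡m j p) (m<n⇒m/n≡0 r<p)) ⟩
        (j + 0) / w                      ≡⟨ cong (_/ w) (ℕ.+-identityʳ j) ⟩
        j / w                            ∎
        where open ≡-Reasoning

    refinement : (+ M *ℤ D - Σ< (p * M) (sgn ∘ a)) ±≤ (+ M *ℤ (+ 2 *ℤ + (2 * (u + v))))
    refinement = subst₂ _±≤_
      (cong (λ x → + M *ℤ x - Σ< (p * M) (sgn ∘ a)) (Σ-cong p (λ b _ → cong sgn (a-sample b))))
      (cong (λ x → + M *ℤ (+ 2 *ℤ x)) (trans (cong₂ (λ x y → + x - + y) a-end a-start) (ℤ.+-identityʳ _)))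
      (sgn-refinement a a-mono M p)

    Σ-blocks : Σ< (p * M) (sgn ∘ a) ≡ + p *ℤ Σ< M wave
    Σ-blocks = begin
      Σ< (p * M) (sgn ∘ a)                                  ≡⟨ cong (λ m → Σ< m (sgn ∘ a)) (ℕ.*-comm p M) ⟩
      Σ< (M * p) (sgn ∘ a)                                  ≡⟨ Σ-block M p (sgn ∘ a) ⟩
      Σ< M (λ j → Σ< p (λ r → sgn (a (j * p + r))))         ≡⟨ Σ-cong M (λ j _ → Σ-cong p (λ r r<p → cong sgn (a-block j r r<p))) ⟩
      Σ< M (λ j → Σ< p (λ _ → wave j))                      ≡⟨ Σ-cong M (λ j _ → Σ-const p (wave j)) ⟩
      Σ< M (λ j → + p *ℤ wave j)                            ≡⟨ Σ-*ˡ M (+ p) wave ⟩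
      + p *ℤ Σ< M wave                                      ∎
      where open ≡-Reasoning

    coarse-bound : Σ< (p * M) (sgn ∘ a) ±≤ (+ p *ℤ + 2)
    coarse-bound rewrite Σ-blocks =
        ℤ.*-monoˡ-≤-nonNeg (+ p) (proj₁ Σ-wave)
      , subst (_≤ℤ + p *ℤ + 2) (sym (ℤ.neg-distribʳ-* (+ p) (Σ< M wave))) (ℤ.*-monoˡ-≤-nonNeg (+ p) (proj₂ Σ-wave))

    combine : (+ M *ℤ D - Σ< (p * M) (sgn ∘ a)) +ℤ Σ< (p * M) (sgn ∘ a) ≡ + 2 *ℤ (+ (u * v) *ℤ D)
    combine = trans (cancel (+ M *ℤ D) _) (trans (cong (_*ℤ D) (ℤ.pos-* 2 (u * v))) (ℤ.*-assoc (+ 2) (+ (u * v)) D))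
      where
      cancel : ∀ x y → (x - y) +ℤ y ≡ x
      cancel = ℤ-ring

    total : + M *ℤ (+ 2 *ℤ + (2 * (u + v))) +ℤ + p *ℤ + 2 ≡ + 2 *ℤ (+ p +ℤ + (4 * (u * v) * (u + v)))
    total = begin
      + M *ℤ (+ 2 *ℤ + (2 * (u + v))) +ℤ + p *ℤ + 2        ≡⟨ cong₂ _+ℤ_ (trans (cong (+ M *ℤ_) (sym (ℤ.pos-* 2 (2 * (u + v))))) (sym (ℤ.pos-* M (2 * (2 * (u + v)))))) (sym (ℤ.pos-* p 2)) ⟩
      + (M * (2 * (2 * (u + v))) + p * 2)                  ≡⟨ cong +_ (regroup (u * v) (u + v) p) ⟩
      + (2 * (p + 4 * (u * v) * (u + v)))                  ≡⟨ ℤ.pos-* 2 (p + 4 * (u * v) * (u + v)) ⟩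
      + 2 *ℤ + (p + 4 * (u * v) * (u + v))                 ∎
      where
      open ≡-Reasoning
      regroup : ∀ m s p → (2 * m) * (2 * (2 * s)) + p * 2 ≡ 2 * (p + 4 * m * s)
      regroup = ℕ-ring

    halve : ∀ {x b} → (+ 2 *ℤ x) ±≤ (+ 2 *ℤ b) → x ±≤ b
    halve {x} {b} (h₁ , h₂) = ℤ.*-cancelˡ-≤-pos x b (+ 2) h₁
      , ℤ.*-cancelˡ-≤-pos (- x) b (+ 2) (subst (_≤ℤ + 2 *ℤ b) (ℤ.neg-distribʳ-* (+ 2) x) h₂)

-- The square wave modulo p

square : (p : ℕ) .{{_ : NonZero p}} → ℕ → ℤ
square p y = sgn ((2 * y) / p)

square-periodic : ∀ p .{{_ : NonZero p}} y k → square p (y + k * p) ≡ square p y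
square-periodic p y k = begin
  sgn ((2 * (y + k * p)) / p)               ≡⟨ cong (λ z → sgn (z / p)) (expand y k p) ⟩
  sgn ((2 * y + 2 * k * p) / p)             ≡⟨ cong sgn (+-distrib-/-∣ʳ (2 * y) (ℕ∣.n∣m*n (2 * k))) ⟩
  sgn ((2 * y) / p + (2 * k * p) / p)       ≡⟨ cong (λ z → sgn ((2 * y) / p + z)) (m*n/n≡m (2 * k) p) ⟩
  sgn ((2 * y) / p + 2 * k)                 ≡⟨ sgn-+ ((2 * y) / p) (2 * k) ⟩
  square p y *ℤ sgn (2 * k)                 ≡⟨ cong (square p y *ℤ_) (sgn-double k) ⟩
  square p y *ℤ + 1                         ≡⟨ ℤ.*-identityʳ _ ⟩
  square p y                                ∎
  where
  open ≡-Reasoning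
  expand : ∀ y k p → 2 * (y + k * p) ≡ 2 * y + 2 * k * p
  expand = ℕ-ring

square-% : ∀ p .{{_ : NonZero p}} y → square p y ≡ square p (y % p)
square-% p y = trans (cong (square p) (m≡m%n+[m/n]*n y p)) (square-periodic p (y % p) (y / p))

square-cong : ∀ p .{{_ : NonZero p}} y z → y % p ≡ z % p → square p y ≡ square p z
square-cong p y z eq = trans (square-% p y) (trans (cong (square p) eq) (sym (square-% p z)))

square-low : ∀ p .{{_ : NonZero p}} r → 2 * r < p → square p r ≡ + 1
square-low p r 2r<p = cong sgn (m<n⇒m/n≡0 2r<p)

square-high : ∀ p .{{_ : NonZero p}} r → p ≤ 2 * r → r < p → square p r ≡ -[1+ 0 ]
square-high p r p≤2r r<p = cong sgn (trans (m/n≡1+[m∸n]/n p≤2r) (cong suc (m<n⇒m/n≡0 2r∸p<p)))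
  where
  2r∸p<p : 2 * r ∸ p < p
  2r∸p<p = ℕ.+-cancelʳ-< p (2 * r ∸ p) p
    (subst₂ _<_ (sym (ℕ.m∸n+n≡m p≤2r)) (cong (λ n → p + n) (ℕ.+-identityʳ p)) (ℕ.*-monoʳ-< 2 r<p))

Σ-indicator : ∀ {P : ℕ → Set} (P? : Decidable P) (σ : ℕ → ℤ) →
              (∀ {a} → P a → σ a ≡ + 1) → (∀ {a} → ¬ P a → σ a ≡ -[1+ 0 ]) → ∀ n f →
              Σ< n (σ ∘ f) ≡ + (2 * length (filter P? (applyUpTo f n))) - + n
Σ-indicator P? σ on off zero    f = refl
Σ-indicator P? σ on off (suc n) f with P? (f 0)
... | yes holds = begin
  σ (f 0) +ℤ Σ< n (σ ∘ f ∘ suc)        ≡⟨ cong₂ _+ℤ_ (on holds) (Σ-indicator P? σ on off n (f ∘ suc)) ⟩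
  + 1 +ℤ (+ (2 * L) - + n)             ≡⟨ regroup (+ (2 * L)) (+ n) ⟩
  (+ 2 +ℤ + (2 * L)) - (+ 1 +ℤ + n)    ≡⟨ cong (λ z → + z - + suc n) (ℕ.*-suc 2 L) ⟨
  + (2 * suc L) - + suc n              ∎
  where
  open ≡-Reasoning
  L = length (filter P? (applyUpTo (f ∘ suc) n))
  regroup : ∀ a b → + 1 +ℤ (a - b) ≡ (+ 2 +ℤ a) - (+ 1 +ℤ b)
  regroup = ℤ-ring
... | no fails = begin
  σ (f 0) +ℤ Σ< n (σ ∘ f ∘ suc)        ≡⟨ cong₂ _+ℤ_ (off fails) (Σ-indicator P? σ on off n (f ∘ suc)) ⟩
  -[1+ 0 ] +ℤ (+ (2 * L) - + n)        ≡⟨ regroup (+ (2 * L)) (+ n) ⟩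
  + (2 * L) - + suc n                  ∎
  where
  open ≡-Reasoning
  L = length (filter P? (applyUpTo (f ∘ suc) n))
  regroup : ∀ a b → -[1+ 0 ] +ℤ (a - b) ≡ a - (+ 1 +ℤ b)
  regroup = ℤ-ring

-- The excess overlap as an autocorrelation of the square wave

module _ (h : ℕ) where

  private
    p = suc (2 * h)

    s : ℕ → ℤ
    s = square p

  ⌈p/2⌉∸1≡h : ((p + 1) / 2) ∸ 1 ≡ h
  ⌈p/2⌉∸1≡h = cong (_∸ 1) (trans (cong (_/ 2) (double h)) (m*n/n≡m (suc h) 2))
    where
    double : ∀ h → suc (2 * h) + 1 ≡ suc h * 2
    double = ℕ-ring

  residues-sum : ∀ {y z} → ¬ p ∣ y → p ∣ y + z → y % p + z % p ≡ p
  residues-sum {y} {z} p∤y p∣y+z = from-quotient (ℕ∣.m%n≡0⇒n∣m (y % p + z % p) p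
      (trans (sym (%-distribˡ-+ y z p)) (ℕ∣.n∣m⇒m%n≡0 (y + z) p p∣y+z)))
    where
    from-quotient : p ∣ y % p + z % p → y % p + z % p ≡ p
    from-quotient (ℕ∣.divides 0 eq) = ⊥-elim (p∤y (ℕ∣.m%n≡0⇒n∣m y p (ℕ.m+n≡0⇒m≡0 (y % p) eq)))
    from-quotient (ℕ∣.divides 1 eq) = trans eq (ℕ.*-identityˡ p)
    from-quotient (ℕ∣.divides (suc (suc k)) eq) = ⊥-elim (ℕ.<⇒≱ (ℕ.+-mono-< (m%n<n y p) (m%n<n z p))
      (ℕ.≤-trans (ℕ.+-monoʳ-≤ p (ℕ.m≤m+n p (k * p))) (ℕ.≤-reflexive (sym eq))))

  -- As `p` is odd, no residue lies on the boundary between the halves, and two nonzero residues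
  -- with sum `p` lie in different halves. The residue 0, where the wave is 1, is its own opposite
  -- and has to be excluded.
  square-antisymmetric : ∀ {y z} → ¬ p ∣ y → p ∣ y + z → s z ≡ - s y
  square-antisymmetric {y} {z} p∤y p∣y+z = begin
    s z            ≡⟨ square-% p z ⟩
    s r′           ≡⟨ opposite (ℕ.≤-<-connex r h) ⟩
    - s r          ≡⟨ cong -_ (square-% p y) ⟨
    - s y          ∎
    where
    open ≡-Reasoning
    r = y % p
    r′ = z % p
    r+r′≡p = residues-sum {y} {z} p∤y p∣y+z

    below : ∀ {t} → t ≤ h → 2 * t < p
    below t≤h = s≤s (ℕ.*-monoʳ-≤ 2 t≤h)

    above : ∀ {t} → h < t → p ≤ 2 * t
    above h<t = ℕ.≤-trans (ℕ.n≤1+n p) (ℕ.≤-trans (ℕ.≤-reflexive (sym (ℕ.*-suc 2 h))) (ℕ.*-monoʳ-≤ 2 h<t))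

    2h+1 : h + suc h ≡ p
    2h+1 = trans (ℕ.+-suc h h) (cong (λ n → suc (h + n)) (sym (ℕ.+-identityʳ h)))

    opposite : r ≤ h ⊎ h < r → s r′ ≡ - s r
    opposite (inj₁ r≤h) = trans (square-high p r′ (above h<r′) (m%n<n z p)) (cong -_ (sym (square-low p r (below r≤h))))
      where
      h<r′ : h < r′
      h<r′ = ℕ.+-cancelˡ-≤ h (suc h) r′
        (ℕ.≤-trans (ℕ.≤-reflexive (trans 2h+1 (sym r+r′≡p))) (ℕ.+-monoˡ-≤ r′ r≤h))
    opposite (inj₂ h<r) = trans (square-low p r′ (below r′≤h)) (cong -_ (sym (square-high p r (above h<r) (m%n<n y p))))
      where
      r′≤h : r′ ≤ h
      r′≤h = ℕ.+-cancelˡ-≤ (suc h) r′ h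
        (ℕ.≤-trans (ℕ.+-monoˡ-≤ r′ h<r) (ℕ.≤-reflexive (trans r+r′≡p (trans (sym 2h+1) (ℕ.+-comm h (suc h))))))

  ¬p∣k*m : ∀ {k m} → Coprime p m → 0 < k → k < p → ¬ p ∣ m * k
  ¬p∣k*m p⊥m 0<k k<p p∣mk = ℕ∣.>⇒∤ {{>-nonZero 0<k}} k<p (coprime-divisor p⊥m p∣mk)

  autocorrelation : ℕ → ℤ
  autocorrelation x = Σ< p (λ a → s a *ℤ s (a * x))

  -- The reflection of `a` to `p - a` flips both factors, so the terms with nonzero `a` come in
  -- equal pairs and the autocorrelation is `1 + 2 H`, with `H` the sum over `a` from 1 to `h`.
  -- There `s a` is 1, so `H` is twice the overlap minus `h`; inserting `p = 2 h + 1` leaves the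
  -- correction 2.
  excess4-autocorrelation : ∀ x → Coprime p x → excess4 p x ≡ autocorrelation x - + 2
  excess4-autocorrelation x p⊥x = begin
    + (4 * ovl p x) - + p                         ≡⟨ cong (λ n → + (4 * length (filter (λ a → 2 * ((a * x) % p) <? p) (applyUpTo suc n))) - + p) ⌈p/2⌉∸1≡h ⟩
    + (4 * L) - + p                               ≡⟨ cong₂ (λ a b → + a - (+ 1 +ℤ b)) (ℕ.*-assoc 2 2 L) (ℤ.pos-* 2 h) ⟩
    + (2 * (2 * L)) - (+ 1 +ℤ + 2 *ℤ + h)         ≡⟨ cong (_- (+ 1 +ℤ + 2 *ℤ + h)) (ℤ.pos-* 2 (2 * L)) ⟩
    + 2 *ℤ + (2 * L) - (+ 1 +ℤ + 2 *ℤ + h)        ≡⟨ regroup (+ (2 * L)) (+ h) ⟩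
    (+ 1 +ℤ ((+ (2 * L) - + h) +ℤ (+ (2 * L) - + h))) - + 2
                                                  ≡⟨ cong (λ z → (+ 1 +ℤ (z +ℤ z)) - + 2) lower ⟨
    (+ 1 +ℤ (H +ℤ H)) - + 2                       ≡⟨ cong (λ z → (+ 1 +ℤ (H +ℤ z)) - + 2) upper ⟨
    (+ 1 +ℤ (H +ℤ Σ< h (λ i → g (suc (h + i))))) - + 2
                                                  ≡⟨ cong (λ z → (+ 1 +ℤ z) - + 2) (Σ-split h h (g ∘ suc)) ⟨
    (+ 1 +ℤ Σ< (h + h) (g ∘ suc)) - + 2           ≡⟨ cong (λ n → (+ 1 +ℤ Σ< (h + n) (g ∘ suc)) - + 2) (ℕ.+-identityʳ h) ⟨
    autocorrelation x - + 2                       ∎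
    where
    open ≡-Reasoning
    g : ℕ → ℤ
    g a = s a *ℤ s (a * x)

    H = Σ< h (g ∘ suc)

    L = length (filter (λ a → 2 * ((a * x) % p) <? p) (applyUpTo suc h))

    regroup : ∀ l h → + 2 *ℤ l - (+ 1 +ℤ + 2 *ℤ h) ≡ (+ 1 +ℤ ((l - h) +ℤ (l - h))) - + 2
    regroup = ℤ-ring

    lower : H ≡ + (2 * L) - + h
    lower = trans
      (Σ-cong h (λ i i<h → trans (cong (_*ℤ s (suc i * x)) (square-low p (suc i) (s≤s (ℕ.*-monoʳ-≤ 2 i<h)))) (ℤ.*-identityˡ _)))
      (Σ-indicator (λ a → 2 * ((a * x) % p) <? p) (λ a → s (a * x))
        (λ {a} low → trans (square-% p (a * x)) (square-low p ((a * x) % p) low))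
        (λ {a} high → trans (square-% p (a * x)) (square-high p ((a * x) % p) (ℕ.≮⇒≥ high) (m%n<n (a * x) p))) h suc)

    upper : Σ< h (λ i → g (suc (h + i))) ≡ H
    upper = trans (Σ-reverse h (λ i → g (suc (h + i)))) (Σ-cong h reflect)
      where
      reflect : ∀ i → i < h → g (suc (h + (h ∸ suc i))) ≡ g (suc i)
      reflect i i<h = begin
        s a′ *ℤ s (a′ * x)          ≡⟨ cong₂ _*ℤ_ (square-antisymmetric {a} p∤a (ℕ∣.∣-reflexive (sym a+a′≡p)))
                                                 (square-antisymmetric {a * x} p∤ax (ℕ∣.divides x ax+a′x≡xp)) ⟩
        - s a *ℤ - s (a * x)        ≡⟨ neg-neg (s a) (s (a * x)) ⟩
        s a *ℤ s (a * x)            ∎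
        where
        a = suc i
        a′ = suc (h + (h ∸ suc i))

        neg-neg : ∀ x y → - x *ℤ - y ≡ x *ℤ y
        neg-neg = ℤ-ring

        a+a′≡p : a + a′ ≡ p
        a+a′≡p = begin
          suc i + suc (h + (h ∸ suc i))     ≡⟨ rotate i h (h ∸ suc i) ⟩
          suc (h + (suc i + (h ∸ suc i)))   ≡⟨ cong (λ n → suc (h + n)) (ℕ.m+[n∸m]≡n i<h) ⟩
          suc (h + h)                       ≡⟨ cong (λ n → suc (h + n)) (ℕ.+-identityʳ h) ⟨
          p                                 ∎
          where
          rotate : ∀ i h t → suc i + suc (h + t) ≡ suc (h + (suc i + t))
          rotate = ℕ-ring

        ax+a′x≡xp : a * x + a′ * x ≡ x * p
        ax+a′x≡xp = trans (sym (ℕ.*-distribʳ-+ x a a′)) (trans (cong (_* x) a+a′≡p) (ℕ.*-comm p x))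

        a<p : a < p
        a<p = s≤s (ℕ.≤-trans i<h (ℕ.m≤m+n h _))

        p∤a : ¬ p ∣ a
        p∤a = ℕ∣.>⇒∤ a<p

        p∤ax : ¬ p ∣ a * x
        p∤ax = ¬p∣k*m p⊥x z<s a<p ∘ subst (p ∣_) (ℕ.*-comm a x)

  autocorrelation-dilate : ∀ x v → Coprime p v → autocorrelation x ≡ Σ< p (λ b → s (v * b) *ℤ s (b * (x * v)))
  autocorrelation-dilate x v p⊥v = trans (sym (Σ-affine p v 0 p⊥v (λ a → s a *ℤ s (a * x))))
    (Σ-cong p (λ b _ → cong₂ _*ℤ_ (square-cong p ((b * v + 0) % p) (v * b) (first b))
                                  (square-cong p ((b * v + 0) % p * x) (b * (x * v)) (second b))))
    where
    open ≡-Reasoning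
    first : ∀ b → (b * v + 0) % p % p ≡ (v * b) % p
    first b = trans (m%n%n≡m%n (b * v + 0) p) (cong (_% p) (trans (ℕ.+-identityʳ (b * v)) (ℕ.*-comm b v)))

    second : ∀ b → ((b * v + 0) % p * x) % p ≡ (b * (x * v)) % p
    second b = begin
      ((b * v + 0) % p * x) % p               ≡⟨ %-distribˡ-* ((b * v + 0) % p) x p ⟩
      ((b * v + 0) % p % p * (x % p)) % p     ≡⟨ cong (λ z → (z * (x % p)) % p) (m%n%n≡m%n (b * v + 0) p) ⟩
      ((b * v + 0) % p * (x % p)) % p         ≡⟨ %-distribˡ-* (b * v + 0) x p ⟨
      ((b * v + 0) * x) % p                   ≡⟨ cong (_% p) (rearrange b v x) ⟩
      (b * (x * v)) % p                       ∎
      where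
      rearrange : ∀ b v x → (b * v + 0) * x ≡ b * (x * v)
      rearrange = ℕ-ring

  crosscorrelation : ℕ → ℕ → ℤ
  crosscorrelation u v = Σ< p (λ b → sgn ((2 * (u * b)) / p + (2 * (v * b)) / p))

  autocorrelation-+ : ∀ x u v → Coprime p v → (x * v) % p ≡ u % p →
                      autocorrelation x ≡ crosscorrelation u v
  autocorrelation-+ x u v p⊥v xv≡u = trans (autocorrelation-dilate x v p⊥v) (Σ-cong p λ b _ → begin
    s (v * b) *ℤ s (b * (x * v))                     ≡⟨ cong (s (v * b) *ℤ_) (square-cong p (b * (x * v)) (u * b) (congruent b)) ⟩
    s (v * b) *ℤ s (u * b)                           ≡⟨ ℤ.*-comm (s (v * b)) (s (u * b)) ⟩
    s (u * b) *ℤ s (v * b)                           ≡⟨ sgn-+ ((2 * (u * b)) / p) ((2 * (v * b)) / p) ⟨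
    sgn ((2 * (u * b)) / p + (2 * (v * b)) / p)      ∎)
    where
    open ≡-Reasoning
    congruent : ∀ b → (b * (x * v)) % p ≡ (u * b) % p
    congruent b = begin
      (b * (x * v)) % p                    ≡⟨ %-distribˡ-* b (x * v) p ⟩
      ((b % p) * ((x * v) % p)) % p        ≡⟨ cong (λ z → ((b % p) * z) % p) xv≡u ⟩
      ((b % p) * (u % p)) % p              ≡⟨ %-distribˡ-* b u p ⟨
      (b * u) % p                          ≡⟨ cong (_% p) (ℕ.*-comm b u) ⟩
      (u * b) % p                          ∎

  -- The square wave is odd except at 0, so every term but the one at 0 changes sign.
  autocorrelation-neg : ∀ x u v → Coprime p v → Coprime p u → p ∣ x * v + u →
                        autocorrelation x ≡ + 2 - crosscorrelation u v
  autocorrelation-neg x u v p⊥v p⊥u p∣xv+u = begin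
    autocorrelation x                                            ≡⟨ autocorrelation-dilate x v p⊥v ⟩
    f 0 +ℤ Σ< (2 * h) (f ∘ suc)                                  ≡⟨ cong₂ _+ℤ_ f-zero (Σ-cong (2 * h) f-suc) ⟩
    + 1 +ℤ Σ< (2 * h) (λ b → - c (suc b))                        ≡⟨ cong (+ 1 +ℤ_) (Σ-neg (2 * h) (c ∘ suc)) ⟩
    + 1 - Σ< (2 * h) (c ∘ suc)                                   ≡⟨ regroup (Σ< (2 * h) (c ∘ suc)) ⟩
    + 2 - (+ 1 +ℤ Σ< (2 * h) (c ∘ suc))                          ≡⟨ cong (λ z → + 2 - (z +ℤ Σ< (2 * h) (c ∘ suc))) c-zero ⟨
    + 2 - crosscorrelation u v                                   ∎
    where
    open ≡-Reasoning
    f c : ℕ → ℤ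
    f b = s (v * b) *ℤ s (b * (x * v))
    c b = sgn ((2 * (u * b)) / p + (2 * (v * b)) / p)

    regroup : ∀ z → + 1 - z ≡ + 2 - (+ 1 +ℤ z)
    regroup = ℤ-ring

    square-zero : ∀ w → s (w * 0) ≡ + 1
    square-zero w = trans (cong s (ℕ.*-zeroʳ w)) refl

    f-zero : f 0 ≡ + 1
    f-zero = cong (_*ℤ s 0) (square-zero v)

    c-zero : c 0 ≡ + 1
    c-zero = trans (sgn-+ ((2 * (u * 0)) / p) ((2 * (v * 0)) / p)) (cong₂ _*ℤ_ (square-zero u) (square-zero v))

    f-suc : ∀ b → b < 2 * h → f (suc b) ≡ - c (suc b)
    f-suc b b<2h = begin
      s (v * k) *ℤ s (k * (x * v))    ≡⟨ cong (s (v * k) *ℤ_) (square-antisymmetric {u * k} (¬p∣k*m p⊥u z<s (s≤s b<2h)) p∣uk+kxv) ⟩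
      s (v * k) *ℤ - s (u * k)        ≡⟨ swap-neg (s (v * k)) (s (u * k)) ⟩
      - (s (u * k) *ℤ s (v * k))      ≡⟨ cong -_ (sgn-+ ((2 * (u * k)) / p) ((2 * (v * k)) / p)) ⟨
      - c k                           ∎
      where
      k = suc b
      swap-neg : ∀ x y → x *ℤ - y ≡ - (y *ℤ x)
      swap-neg = ℤ-ring

      factor : ∀ u k y → k * (y + u) ≡ u * k + k * y
      factor = ℕ-ring

      p∣uk+kxv : p ∣ u * k + k * (x * v)
      p∣uk+kxv = subst (p ∣_) (factor u k (x * v)) (ℕ∣.∣n⇒∣m*n k p∣xv+u)

  -- A trivial bound that serves the residue 0, which has no genuine approximating fraction.
  excess4≤p : ∀ x → excess4 p x ≤ℤ + p
  excess4≤p x = begin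
    + (4 * ovl p x) - + p      ≤⟨ ℤ.+-monoˡ-≤ (- + p) (+≤+ (ℕ.≤-trans (ℕ.*-monoʳ-≤ 4 ovl≤h) 4h≤2p)) ⟩
    (+ p +ℤ + p) - + p         ≡⟨ cancel (+ p) ⟩
    + p                        ∎
    where
    open ℤ.≤-Reasoning
    cancel : ∀ a → (a +ℤ a) - a ≡ a
    cancel = ℤ-ring

    ovl≤h : ovl p x ≤ h
    ovl≤h = ℕ.≤-trans (length-filter (λ a → 2 * ((a * x) % p) <? p) (applyUpTo suc (((p + 1) / 2) ∸ 1)))
                      (ℕ.≤-reflexive (trans (length-applyUpTo suc (((p + 1) / 2) ∸ 1)) ⌈p/2⌉∸1≡h))

    4h≤2p : 4 * h ≤ p + p
    4h≤2p = subst (4 * h ≤_) (sym (expand h)) (ℕ.m≤m+n (4 * h) 2)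
      where
      expand : ∀ h → suc (2 * h) + suc (2 * h) ≡ 4 * h + 2
      expand = ℕ-ring

-- Rational approximation modulo p

∣-∣-≤ : ∀ {a b} → a ≤ b → ∣ + a - + b ∣ ≡ b ∸ a
∣-∣-≤ {a} {b} a≤b = trans (cong ∣_∣ (ℤ.m-n≡m⊖n a b)) (ℤ.∣⊖∣-≤ a≤b)

∣-∣-≥ : ∀ {a b} → b ≤ a → ∣ + a - + b ∣ ≡ a ∸ b
∣-∣-≥ {a} {b} b≤a = trans (ℤ.∣i-j∣≡∣j-i∣ (+ a) (+ b)) (∣-∣-≤ b≤a)

∣ℤ⇒%≡ : ∀ p .{{_ : NonZero p}} {a b} → + p ∣ℤ (+ a - + b) → a % p ≡ b % p
∣ℤ⇒%≡ p {a} {b} p∣a-b with ℕ.≤-total a b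
... | inj₁ a≤b = sym (trans (cong (_% p) (sym (ℕ.m+[n∸m]≡n a≤b)))
                            (%-remove-+ʳ a (subst (p ∣_) (∣-∣-≤ a≤b) (ℤ∣.∣⇒∣ᵤ p∣a-b))))
... | inj₂ b≤a = trans (cong (_% p) (sym (ℕ.m+[n∸m]≡n b≤a)))
                       (%-remove-+ʳ b (subst (p ∣_) (∣-∣-≥ b≤a) (ℤ∣.∣⇒∣ᵤ p∣a-b)))

euclid-ℤ : ∀ {p} → Prime p → ∀ i k → ¬ p ∣ k → + p ∣ℤ (i *ℤ + k) → + p ∣ℤ i
euclid-ℤ {p} pr i k p∤k p∣ik with euclidsLemma ∣ i ∣ k pr (subst (p ∣_) (ℤ.abs-* i (+ k)) (ℤ∣.∣⇒∣ᵤ p∣ik))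
... | inj₁ p∣i = ℤ∣.∣ᵤ⇒∣ p∣i
... | inj₂ p∣k = ⊥-elim (p∤k p∣k)

quotient≡⇒∸≤ : ∀ d a b → a / suc d ≡ b / suc d → b ∸ a ≤ d
quotient≡⇒∸≤ d a b eq = begin
  b ∸ a                                                    ≡⟨ cong₂ _∸_ (m≡m%n+[m/n]*n b (suc d)) (m≡m%n+[m/n]*n a (suc d)) ⟩
  (b % suc d + b / suc d * suc d) ∸ (a % suc d + a / suc d * suc d)
                                                           ≡⟨ cong (λ q → (b % suc d + b / suc d * suc d) ∸ (a % suc d + q * suc d)) eq ⟩
  (b % suc d + b / suc d * suc d) ∸ (a % suc d + b / suc d * suc d)
                                                           ≤⟨ ℕ.∸-monoʳ-≤ _ (ℕ.m≤n+m (b / suc d * suc d) (a % suc d)) ⟩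
  (b % suc d + b / suc d * suc d) ∸ b / suc d * suc d      ≡⟨ ℕ.m+n∸n≡m (b % suc d) (b / suc d * suc d) ⟩
  b % suc d                                                ≤⟨ ℕ.<⇒≤pred (m%n<n b (suc d)) ⟩
  d                                                        ∎
  where open ℕ.≤-Reasoning

quotient≡⇒close : ∀ d {a b} → a / suc d ≡ b / suc d → ∣ + a - + b ∣ ≤ d
quotient≡⇒close d {a} {b} eq with ℕ.≤-total a b
... | inj₁ a≤b = subst (_≤ d) (sym (∣-∣-≤ a≤b)) (quotient≡⇒∸≤ d a b eq)
... | inj₂ b≤a = subst (_≤ d) (sym (∣-∣-≥ b≤a)) (quotient≡⇒∸≤ d b a (sym eq))

-- Pigeonhole: the `n + 1` residues of `x * k` for `k` from 0 to `n` fall into `n` boxes of width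
-- `suc (p / n)`. This width is large enough for the boxes to cover all residues, and two residues
-- in one box differ by at most `p / n`. The indices and the residues are subtracted in the same
-- order, which leaves `u` signed.
dirichlet : ∀ p n x .{{_ : NonZero p}} .{{_ : NonZero n}} →
            ∃₂ λ v u → 0 < v × v ≤ n × ∣ u ∣ ≤ p / n × + p ∣ℤ (+ (x * v) - u)
dirichlet p n x with pigeonhole (ℕ.n<1+n n) (λ k → fromℕ< (box< (toℕ k)))
  where
  box< : ∀ k → (x * k % p) / suc (p / n) < n
  box< k = m<n*o⇒m/o<n (ℕ.<-trans (m%n<n (x * k) p) (begin-strict
    p                      ≡⟨ m≡m%n+[m/n]*n p n ⟩
    p % n + p / n * n      <⟨ ℕ.+-monoˡ-< (p / n * n) (m%n<n p n) ⟩
    suc (p / n) * n        ≡⟨ ℕ.*-comm (suc (p / n)) n ⟩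
    n * suc (p / n)        ∎))
    where open ℕ.≤-Reasoning
... | i , j , i<j , eq =
    toℕ j ∸ toℕ i , + r (toℕ j) - + r (toℕ i)
  , ℕ.m<n⇒0<n∸m i<j
  , ℕ.≤-trans (ℕ.m∸n≤m (toℕ j) (toℕ i)) (ℕ.<⇒≤pred (toℕ<n j))
  , quotient≡⇒close (p / n) {r (toℕ j)} {r (toℕ i)}
      (sym (trans (sym (toℕ-fromℕ< _)) (trans (cong toℕ eq) (toℕ-fromℕ< _))))
  , divides (+ q (toℕ j) - + q (toℕ i)) congruence
  where
  r q : ℕ → ℕ
  r k = x * k % p
  q k = x * k / p

  split : ∀ k → + (x * k) ≡ + r k +ℤ + q k *ℤ + p
  split k = trans (cong +_ (m≡m%n+[m/n]*n (x * k) p)) (cong (+ r k +ℤ_) (ℤ.pos-* (q k) p))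

  congruence : + (x * (toℕ j ∸ toℕ i)) - (+ r (toℕ j) - + r (toℕ i)) ≡ (+ q (toℕ j) - + q (toℕ i)) *ℤ + p
  congruence = begin
    + (x * (toℕ j ∸ toℕ i)) - (+ rj - + ri)              ≡⟨ cong (λ z → + z - (+ rj - + ri)) (ℕ.*-distribˡ-∸ x (toℕ j) (toℕ i)) ⟩
    + (x * toℕ j ∸ x * toℕ i) - (+ rj - + ri)            ≡⟨ cong (_- (+ rj - + ri)) (trans (ℤ.m-n≡m⊖n (x * toℕ j) (x * toℕ i)) (ℤ.⊖-≥ (ℕ.*-monoʳ-≤ x (ℕ.<⇒≤ i<j)))) ⟨
    (+ (x * toℕ j) - + (x * toℕ i)) - (+ rj - + ri)      ≡⟨ cong₂ (λ y z → (y - z) - (+ rj - + ri)) (split (toℕ j)) (split (toℕ i)) ⟩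
    ((+ rj +ℤ + q (toℕ j) *ℤ + p) - (+ ri +ℤ + q (toℕ i) *ℤ + p)) - (+ rj - + ri)
                                                         ≡⟨ cancel (+ rj) (+ ri) (+ q (toℕ j)) (+ q (toℕ i)) (+ p) ⟩
    (+ q (toℕ j) - + q (toℕ i)) *ℤ + p                   ∎
    where
    open ≡-Reasoning
    rj = r (toℕ j)
    ri = r (toℕ i)
    cancel : ∀ a b c d p → ((a +ℤ c *ℤ p) - (b +ℤ d *ℤ p)) - (a - b) ≡ (c - d) *ℤ p
    cancel = ℤ-ring

record Approximation (p n x v : ℕ) (u : ℤ) .{{_ : NonZero n}} : Set where
  field
    v>0       : 0 < v
    v≤n       : v ≤ n
    ∣u∣≤p/n   : ∣ u ∣ ≤ p / n
    v⊥u       : Coprime v ∣ u ∣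
    p∣xv-u    : + p ∣ℤ (+ (x * v) - u)

-- Lowest terms are required by the correlation bound. Dividing out the gcd `g` keeps the
-- congruence, because `g` is at most `v`, hence below `p`, and so is invertible modulo `p`.
approximate : ∀ {p n} → Prime p → .{{_ : NonZero n}} → n < p → ∀ x → ∃₂ λ v u → Approximation p n x v u
approximate {p} {n} pr n<p x with dirichlet p n x {{prime⇒nonZero pr}}
... | v , u , v>0 , v≤n , ∣u∣≤p/n , p∣xv-u = reduce (gcd[m,n]∣m v ∣ u ∣) (ℤ∣.∣ᵤ⇒∣ {+ g} {u} (gcd[m,n]∣n v ∣ u ∣))
  where
  g = gcd v ∣ u ∣

  instance
    g≢0 : NonZero g
    g≢0 = ≢-nonZero (gcd[m,n]≢0 v ∣ u ∣ (inj₁ (λ v≡0 → ℕ.<⇒≢ v>0 (sym v≡0))))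

  reduce : g ∣ v → + g ∣ℤ u → ∃₂ λ v u → Approximation p n x v u
  reduce (ℕ∣.divides v′ v≡v′g) (divides u′ u≡u′g) = v′ , u′ , record
    { v>0     = ℕ.n≢0⇒n>0 (λ v′≡0 → ℕ.<⇒≢ v>0 (sym (trans v≡v′g (cong (_* g) v′≡0))))
    ; v≤n     = ℕ.≤-trans (subst (v′ ≤_) (sym v≡v′g) (ℕ.m≤m*n v′ g)) v≤n
    ; ∣u∣≤p/n = ℕ.≤-trans (subst (∣ u′ ∣ ≤_) (sym ∣u∣≡∣u′∣g) (ℕ.m≤m*n ∣ u′ ∣ g)) ∣u∣≤p/n
    ; v⊥u     = subst₂ Coprime (trans (cong (_/ g) v≡v′g) (m*n/n≡m v′ g))
                               (trans (cong (_/ g) ∣u∣≡∣u′∣g) (m*n/n≡m ∣ u′ ∣ g)) (coprime-/gcd v ∣ u ∣)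
    ; p∣xv-u  = euclid-ℤ pr (+ (x * v′) - u′) g p∤g (subst (+ p ∣ℤ_) factor p∣xv-u)
    }
    where
    ∣u∣≡∣u′∣g : ∣ u ∣ ≡ ∣ u′ ∣ * g
    ∣u∣≡∣u′∣g = trans (cong ∣_∣ u≡u′g) (ℤ.abs-* u′ (+ g))

    p∤g : ¬ p ∣ g
    p∤g = ℕ∣.>⇒∤ (ℕ.≤-<-trans (ℕ.≤-trans (ℕ∣.∣⇒≤ {{>-nonZero v>0}} (gcd[m,n]∣m v ∣ u ∣)) v≤n) n<p)

    factor : + (x * v) - u ≡ (+ (x * v′) - u′) *ℤ + g
    factor = begin
      + (x * v) - u                          ≡⟨ cong₂ (λ a b → + (x * a) - b) v≡v′g u≡u′g ⟩
      + (x * (v′ * g)) - u′ *ℤ + g           ≡⟨ cong (λ a → + a - u′ *ℤ + g) (ℕ.*-assoc x v′ g) ⟨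
      + (x * v′ * g) - u′ *ℤ + g             ≡⟨ cong (_- u′ *ℤ + g) (ℤ.pos-* (x * v′) g) ⟩
      + (x * v′) *ℤ + g - u′ *ℤ + g          ≡⟨ distrib (+ (x * v′)) u′ (+ g) ⟩
      (+ (x * v′) - u′) *ℤ + g               ∎
      where
      open ≡-Reasoning
      distrib : ∀ a b g → a *ℤ g - b *ℤ g ≡ (a - b) *ℤ g
      distrib = ℤ-ring

-- Bound for a single residue

≤-quotient : ∀ k e p c .{{_ : NonZero k}} → (+ k *ℤ e) ≤ℤ (+ p +ℤ + (k * c)) → e ≤ℤ + (p / k + c)
≤-quotient k -[1+ _ ] p c _  = -≤+
≤-quotient k (+ n)    p c ke≤ = +≤+ (begin
  n                        ≡⟨ m*n/n≡m n k ⟨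
  n * k / k                ≤⟨ /-monoˡ-≤ k (subst₂ _≤_ (ℕ.*-comm k n) (cong (λ z → p + z) (ℕ.*-comm k c))
                                (ℤ.drop‿+≤+ (subst (_≤ℤ + p +ℤ + (k * c)) (sym (ℤ.pos-* k n)) ke≤))) ⟩
  (p + c * k) / k          ≡⟨ +-distrib-/-∣ʳ p (ℕ∣.n∣m*n c) ⟩
  p / k + c * k / k        ≡⟨ cong (λ z → p / k + z) (m*n/n≡m c k) ⟩
  p / k + c                ∎)
  where open ℕ.≤-Reasoning

infixl 7 _div₀_

-- The default value `m` at divisor 0 gives the fraction 0/0 the weight `p`, just enough for the
-- trivial bound at the residue 0. It also costs no more than one dyadic block in the harmonic sums.
_div₀_ : ℕ → ℕ → ℕ
m div₀ zero  = m
m div₀ suc k = m / suc k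

module _ (h : ℕ) where

  private
    p = suc (2 * h)

  -- The two alternatives for `e` correspond to the two signs of the numerator. Writing the main
  -- term as an iterated quotient lets the later double sum be carried out one variable at a time.
  crosscorrelation-bound : ∀ u v → .{{_ : NonZero u}} → .{{_ : NonZero v}} → Coprime v u → ∀ e →
    e ≤ℤ crosscorrelation h u v ⊎ e ≤ℤ - crosscorrelation h u v → e ≤ℤ + (p div₀ v div₀ u + 4 * (u + v))
  crosscorrelation-bound u@(suc _) v@(suc _) v⊥u e e≤ = begin
    e                                          ≤⟨ ≤-quotient (u * v) e p (4 * (u + v)) (scaled e≤) ⟩
    + (p / (u * v) + 4 * (u + v))              ≡⟨ cong (λ z → + (z + 4 * (u + v))) (trans (/-congʳ {m = p} (ℕ.*-comm u v)) (sym (m/n/o≡m/[n*o] p v u))) ⟩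
    + (p / v / u + 4 * (u + v))                ∎
    where
    open ℤ.≤-Reasoning
    D = crosscorrelation h u v

    both : (+ (u * v) *ℤ D) ±≤ (+ p +ℤ + (u * v * (4 * (u + v))))
    both = subst (λ z → (+ (u * v) *ℤ D) ±≤ (+ p +ℤ + z)) (reorder (u * v) (u + v)) (correlation-bound u v v⊥u p)
      where
      reorder : ∀ m s → 4 * m * s ≡ m * (4 * s)
      reorder = ℕ-ring

    scaled : e ≤ℤ D ⊎ e ≤ℤ - D → (+ (u * v) *ℤ e) ≤ℤ (+ p +ℤ + (u * v * (4 * (u + v))))
    scaled (inj₁ e≤D)  = ℤ.≤-trans (ℤ.*-monoˡ-≤-nonNeg (+ (u * v)) e≤D) (proj₁ both)
    scaled (inj₂ e≤-D) = ℤ.≤-trans (ℤ.*-monoˡ-≤-nonNeg (+ (u * v)) e≤-D)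
      (subst (_≤ℤ (+ p +ℤ + (u * v * (4 * (u + v))))) (ℤ.neg-distribʳ-* (+ (u * v)) D) (proj₂ both))

  excess4-bound : ∀ {n} .{{_ : NonZero n}} → Prime p → 1 < n → n < p → ∀ x v u → 0 < x → x < p →
                  Approximation p n x v u → excess4 p x ≤ℤ + (p div₀ v div₀ ∣ u ∣ + 4 * (p / n + n))
  excess4-bound {n} pr 1<n n<p x v u 0<x x<p approx = ℤ.≤-trans (by-sign u ∣u∣≤p/n v⊥u p∣xv-u)
    (+≤+ (ℕ.+-monoʳ-≤ (p div₀ v div₀ ∣ u ∣) (ℕ.*-monoʳ-≤ 4 (ℕ.+-mono-≤ ∣u∣≤p/n v≤n))))
    where
    open Approximation approx

    p⊥ : ∀ {m} → 0 < m → m < p → Coprime p m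
    p⊥ 0<m m<p = prime⇒coprime pr {{>-nonZero 0<m}} m<p

    v<p : v < p
    v<p = ℕ.≤-<-trans v≤n n<p

    p∤xv : ¬ p ∣ x * v
    p∤xv p∣xv = ℕ∣.>⇒∤ {{>-nonZero v>0}} v<p (coprime-divisor (p⊥ 0<x x<p) p∣xv)

    x-2≤x : ∀ a → a - + 2 ≤ℤ a
    x-2≤x a = ℤ.i≤j⇒i-k≤j (+ 2) ℤ.≤-refl

    by-sign : ∀ u → ∣ u ∣ ≤ p / n → Coprime v ∣ u ∣ → + p ∣ℤ (+ (x * v) - u) →
              excess4 p x ≤ℤ + (p div₀ v div₀ ∣ u ∣ + 4 * (∣ u ∣ + v))
    -- A zero numerator would make `p` divide `x * v`, although both factors are positive and below
    -- `p`.
    by-sign (+ zero) _ _ p∣xv-u = ⊥-elim (p∤xv (subst (p ∣_) (ℕ.+-identityʳ (x * v)) (ℤ∣.∣⇒∣ᵤ p∣xv-u)))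
    by-sign (+ suc m) _ v⊥u p∣xv-u = crosscorrelation-bound (suc m) v {{_}} {{>-nonZero v>0}} v⊥u _ (inj₁ (begin
      excess4 p x                                  ≡⟨ excess4-autocorrelation h x (p⊥ 0<x x<p) ⟩
      autocorrelation h x - + 2                    ≤⟨ x-2≤x _ ⟩
      autocorrelation h x                          ≡⟨ autocorrelation-+ h x (suc m) v (p⊥ v>0 v<p) (∣ℤ⇒%≡ p {x * v} {suc m} p∣xv-u) ⟩
      crosscorrelation h (suc m) v                 ∎))
      where open ℤ.≤-Reasoning
    by-sign -[1+ m ] u≤ v⊥u p∣xv-u = crosscorrelation-bound (suc m) v {{_}} {{>-nonZero v>0}} v⊥u _ (inj₂ (begin
      excess4 p x                                  ≡⟨ excess4-autocorrelation h x (p⊥ 0<x x<p) ⟩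
      autocorrelation h x - + 2                    ≡⟨ cong (_- + 2) (autocorrelation-neg h x (suc m) v (p⊥ v>0 v<p)
                                                        (p⊥ z<s (ℕ.≤-<-trans u≤ (m/n<m p n 1<n))) (ℤ∣.∣⇒∣ᵤ p∣xv-u)) ⟩
      -- The 2 produced by the term at 0, where the wave is not odd, cancels exactly against the
      -- correction in the autocorrelation identity.
      (+ 2 - crosscorrelation h (suc m) v) - + 2   ≡⟨ cancel (crosscorrelation h (suc m) v) ⟩
      - crosscorrelation h (suc m) v               ∎))
      where
      open ℤ.≤-Reasoning
      cancel : ∀ d → (+ 2 - d) - + 2 ≡ - d
      cancel = ℤ-ring

-- Summation over distinct approximating fractions

weight : ℕ → ℕ × ℤ → ℤ
weight p (v , u) = + (p div₀ v div₀ ∣ u ∣)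

div₀-≤ : ∀ m k {j} .{{_ : NonZero k}} → k ≤ j → m div₀ j ≤ m / k
div₀-≤ m (suc k) {suc j} k≤j = /-monoʳ-≤ m k≤j

-- Each dyadic block [2^k, 2^(k+1)) contributes at most m.
Σ-div₀ : ∀ m k → Σ< (2 ^ k) (λ u → + (m div₀ u)) ≤ℤ + (suc k * m)
Σ-div₀ m zero    = ℤ.≤-refl
Σ-div₀ m (suc k) = begin
  Σ< (b + (b + 0)) f                              ≡⟨ cong (λ c → Σ< (b + c) f) (ℕ.+-identityʳ b) ⟩
  Σ< (b + b) f                                    ≡⟨ Σ-split b b f ⟩
  Σ< b f +ℤ Σ< b (λ i → f (b + i))                ≤⟨ ℤ.+-mono-≤ (Σ-div₀ m k) upper ⟩
  + (suc k * m) +ℤ + m                            ≡⟨ cong +_ (ℕ.+-comm (suc k * m) m) ⟩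
  + (suc (suc k) * m)                             ∎
  where
  open ℤ.≤-Reasoning
  b = 2 ^ k
  f : ℕ → ℤ
  f u = + (m div₀ u)

  instance
    b≢0 : NonZero b
    b≢0 = ℕ.m^n≢0 2 k

  upper : Σ< b (λ i → f (b + i)) ≤ℤ + m
  upper = begin
    Σ< b (λ i → f (b + i))        ≤⟨ Σ-mono b (λ i _ → +≤+ (div₀-≤ m b (ℕ.m≤m+n b i))) ⟩
    Σ< b (λ _ → + (m / b))        ≡⟨ Σ-const b (+ (m / b)) ⟩
    + b *ℤ + (m / b)              ≡⟨ ℤ.pos-* b (m / b) ⟨
    + (b * (m / b))               ≤⟨ +≤+ (ℕ.≤-trans (ℕ.≤-reflexive (ℕ.*-comm b (m / b))) (m/n*n≤m m b)) ⟩
    + m                           ∎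

sumℤ-cartesianProduct : ∀ {a b} {A : Set a} {B : Set b} (w : A × B → ℤ) xs ys →
  sumℤ (map w (cartesianProduct xs ys)) ≡ sumℤ (map (λ x → sumℤ (map (λ y → w (x , y)) ys)) xs)
sumℤ-cartesianProduct w []       ys = refl
sumℤ-cartesianProduct w (x ∷ xs) ys = begin
  sumℤ (map w (map (x ,_) ys ++ cartesianProduct xs ys))
    ≡⟨ cong sumℤ (map-++ w (map (x ,_) ys) (cartesianProduct xs ys)) ⟩
  sumℤ (map w (map (x ,_) ys) ++ map w (cartesianProduct xs ys))
    ≡⟨ sumℤ-++ (map w (map (x ,_) ys)) (map w (cartesianProduct xs ys)) ⟩
  sumℤ (map w (map (x ,_) ys)) +ℤ sumℤ (map w (cartesianProduct xs ys))
    ≡⟨ cong₂ _+ℤ_ (cong sumℤ (sym (map-∘ ys))) (sumℤ-cartesianProduct w xs ys) ⟩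
  sumℤ (map (λ y → w (x , y)) ys) +ℤ sumℤ (map (λ x → sumℤ (map (λ y → w (x , y)) ys)) xs)
    ∎
  where open ≡-Reasoning

-- 0 is listed twice. This is harmless, since the list only dominates a sum of nonnegative weights.
interval : ℕ → List ℤ
interval b = map +_ (upTo b) ++ map (-_ ∘ +_) (upTo b)

∈-interval : ∀ {b} u → ∣ u ∣ < b → u ∈ interval b
∈-interval     (+ m)    m<b = ∈-++⁺ˡ (∈-map⁺ +_ (∈-upTo⁺ m<b))
∈-interval {b} -[1+ m ] m<b = ∈-++⁺ʳ (map +_ (upTo b)) (∈-map⁺ (-_ ∘ +_) (∈-upTo⁺ m<b))

Σ-interval : ∀ m k → sumℤ (map (λ u → + (m div₀ ∣ u ∣)) (interval (2 ^ k))) ≤ℤ + (2 * suc k * m)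
Σ-interval m k = begin
  sumℤ (map f (interval b))                                          ≡⟨ cong sumℤ (map-++ f (map +_ (upTo b)) (map (-_ ∘ +_) (upTo b))) ⟩
  sumℤ (map f (map +_ (upTo b)) ++ map f (map (-_ ∘ +_) (upTo b)))   ≡⟨ sumℤ-++ (map f (map +_ (upTo b))) _ ⟩
  sumℤ (map f (map +_ (upTo b))) +ℤ sumℤ (map f (map (-_ ∘ +_) (upTo b)))
                                                                     ≡⟨ cong₂ _+ℤ_ (half +_ (λ _ → refl)) (half (-_ ∘ +_) (ℤ.∣-i∣≡∣i∣ ∘ +_)) ⟩
  S +ℤ S                                                             ≤⟨ ℤ.+-mono-≤ (Σ-div₀ m k) (Σ-div₀ m k) ⟩
  + (suc k * m + suc k * m)                                          ≡⟨ cong +_ (double (suc k) m) ⟩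
  + (2 * suc k * m)                                                  ∎
  where
  open ℤ.≤-Reasoning
  b = 2 ^ k
  f : ℤ → ℤ
  f u = + (m div₀ ∣ u ∣)
  S = Σ< b (λ u → + (m div₀ u))

  double : ∀ k m → k * m + k * m ≡ 2 * k * m
  double = ℕ-ring

  half : ∀ (ι : ℕ → ℤ) → (∀ i → ∣ ι i ∣ ≡ i) → sumℤ (map f (map ι (upTo b))) ≡ S
  half ι ∣ι∣ = trans (cong sumℤ (trans (sym (map-∘ (upTo b))) (map-upTo (f ∘ ι) b)))
                     (Σ-cong b (λ i _ → cong (λ a → + (m div₀ a)) (∣ι∣ i)))

fractions : ℕ → ℕ → List (ℕ × ℤ)
fractions l k = cartesianProduct (upTo (2 ^ l)) (interval (2 ^ k))

-- All pairs in the box are counted, reduced or not. The sum over `u` at fixed `v` costs a factor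
-- `2 * suc k`, with the 2 for the two signs, and the sum over `v` costs `suc l`.
Σ-weight-fractions : ∀ p l k → sumℤ (map (weight p) (fractions l k)) ≤ℤ + (2 * suc k * (suc l * p))
Σ-weight-fractions p l k = begin
  sumℤ (map (weight p) (fractions l k))          ≡⟨ sumℤ-cartesianProduct (weight p) (upTo (2 ^ l)) (interval (2 ^ k)) ⟩
  sumℤ (map row (upTo (2 ^ l)))                  ≡⟨ cong sumℤ (map-upTo row (2 ^ l)) ⟩
  Σ< (2 ^ l) row                                 ≤⟨ Σ-mono (2 ^ l) (λ v _ → Σ-interval (p div₀ v) k) ⟩
  Σ< (2 ^ l) (λ v → + (2 * suc k * (p div₀ v)))  ≡⟨ Σ-cong (2 ^ l) (λ v _ → ℤ.pos-* (2 * suc k) (p div₀ v)) ⟩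
  Σ< (2 ^ l) (λ v → + (2 * suc k) *ℤ + (p div₀ v))
                                                 ≡⟨ Σ-*ˡ (2 ^ l) (+ (2 * suc k)) (λ v → + (p div₀ v)) ⟩
  + (2 * suc k) *ℤ Σ< (2 ^ l) (λ v → + (p div₀ v))
                                                 ≤⟨ ℤ.*-monoˡ-≤-nonNeg (+ (2 * suc k)) (Σ-div₀ p l) ⟩
  + (2 * suc k) *ℤ + (suc l * p)                 ≡⟨ ℤ.pos-* (2 * suc k) (suc l * p) ⟨
  + (2 * suc k * (suc l * p))                    ∎
  where
  open ℤ.≤-Reasoning
  row : ℕ → ℤ
  row v = sumℤ (map (λ u → weight p (v , u)) (interval (2 ^ k)))

-- The residue 0 gets the junk fraction 0/0, whose weight is p.
IsFraction : (p n x : ℕ) .{{_ : NonZero n}} → ℕ × ℤ → Set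
IsFraction p n x (v , u) = (x ≡ 0 × v ≡ 0 × u ≡ + 0) ⊎ (x ≢ 0 × Approximation p n x v u)

module _ {p n : ℕ} (pr : Prime p) .{{_ : NonZero n}} (n<p : n < p) where

  fraction : ∀ x → ∃[ c ] IsFraction p n x c
  fraction zero      = (0 , + 0) , inj₁ (refl , refl , refl)
  fraction x@(suc _) = let v , u , approx = approximate pr n<p x in (v , u) , inj₂ ((λ ()) , approx)

  -- Subtracting the congruences for a shared fraction shows that `p` divides `(x - y) * v`, and `v`
  -- is invertible modulo `p`. A genuine fraction has a positive denominator, so it never meets the
  -- junk one.
  IsFraction-injective : ∀ {x y c} → x < p → y < p → IsFraction p n x c → IsFraction p n y c → x ≡ y
  IsFraction-injective _ _ (inj₁ (refl , _)) (inj₁ (refl , _)) = refl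
  IsFraction-injective _ _ (inj₁ (_ , refl , _)) (inj₂ (_ , approx)) = ⊥-elim (ℕ.<-irrefl refl (Approximation.v>0 approx))
  IsFraction-injective _ _ (inj₂ (_ , approx)) (inj₁ (_ , refl , _)) = ⊥-elim (ℕ.<-irrefl refl (Approximation.v>0 approx))
  IsFraction-injective {x} {y} {v , u} x<p y<p (inj₂ (_ , ax)) (inj₂ (_ , ay)) = begin
    x        ≡⟨ m<n⇒m%n≡m x<p ⟨
    x % p    ≡⟨ ∣ℤ⇒%≡ p {x} {y} (euclid-ℤ pr (+ x - + y) v p∤v (subst (+ p ∣ℤ_) factor (ℤ∣.∣m∣n⇒∣m-n (p∣xv-u ax) (p∣xv-u ay)))) ⟩
    y % p    ≡⟨ m<n⇒m%n≡m y<p ⟩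
    y        ∎
    where
    open ≡-Reasoning
    open Approximation

    instance
      p≢0 : NonZero p
      p≢0 = prime⇒nonZero pr

    p∤v : ¬ p ∣ v
    p∤v = ℕ∣.>⇒∤ {{>-nonZero (v>0 ax)}} (ℕ.≤-<-trans (v≤n ax) n<p)

    factor : (+ (x * v) - u) - (+ (y * v) - u) ≡ (+ x - + y) *ℤ + v
    factor = trans (cong₂ (λ a b → (a - u) - (b - u)) (ℤ.pos-* x v) (ℤ.pos-* y v)) (distrib (+ x) (+ y) (+ v) u)
      where
      distrib : ∀ x y v u → (x *ℤ v - u) - (y *ℤ v - u) ≡ (x - y) *ℤ v
      distrib = ℤ-ring

  fractionOf : Fin p → ℕ × ℤ
  fractionOf x = proj₁ (fraction (toℕ x))

  fractionOf-injective : ∀ {x y} → fractionOf x ≡ fractionOf y → x ≡ y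
  fractionOf-injective {x} {y} eq = toℕ-injective (IsFraction-injective (toℕ<n x) (toℕ<n y)
    (proj₂ (fraction (toℕ x))) (subst (IsFraction p n (toℕ y)) (sym eq) (proj₂ (fraction (toℕ y)))))

IsFraction-∈ : ∀ {p n} → Prime p → 1 < n → .{{_ : NonZero n}} → ∀ {l k} → n < 2 ^ l → p < 2 ^ k →
               ∀ {x c} → IsFraction p n x c → c ∈ fractions l k
IsFraction-∈ {p} {n} pr 1<n {l} {k} n<2^l p<2^k {c = v , u} c-fraction =
  ∈-cartesianProduct⁺ (∈-upTo⁺ (ℕ.≤-<-trans (proj₁ (bounds c-fraction)) n<2^l))
                      (∈-interval u (ℕ.≤-<-trans (proj₂ (bounds c-fraction)) p<2^k))
  where
  bounds : ∀ {x} → IsFraction p n x (v , u) → v ≤ n × ∣ u ∣ ≤ p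
  bounds (inj₁ (_ , refl , refl)) = z≤n , z≤n
  -- The crude bound by `p` suffices, since the size of the box enters only through its logarithm.
  bounds (inj₂ (_ , approx)) = Approximation.v≤n approx , ℕ.≤-trans (Approximation.∣u∣≤p/n approx) (m/n≤m p n)

excess4-IsFraction : ∀ h {n} .{{_ : NonZero n}} → let p = suc (2 * h) in Prime p → 1 < n → n < p →
  ∀ {x c} → x < p → IsFraction p n x c → excess4 p x ≤ℤ weight p c +ℤ + (4 * (p / n + n))
excess4-IsFraction h pr 1<n n<p {x} _ (inj₁ (_ , refl , refl)) =
  ℤ.≤-trans (excess4≤p h x) (+≤+ (ℕ.m≤m+n _ _))
excess4-IsFraction h pr 1<n n<p {x} {v , u} x<p (inj₂ (x≢0 , approx)) =
  excess4-bound h pr 1<n n<p x v u (ℕ.n≢0⇒n>0 x≢0) x<p approx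

sumExcess4-bound : ∀ h {n} .{{_ : NonZero n}} → let p = suc (2 * h) in (pr : Prime p) → 1 < n → (n<p : n < p) → ∀ X →
  sumExcess4 p X ≤ℤ sumℤ (map (weight p) (map (fractionOf pr n<p) X)) +ℤ + (length X * (4 * (p / n + n)))
sumExcess4-bound h pr 1<n n<p [] = ℤ.≤-refl
sumExcess4-bound h {n} pr 1<n n<p (x ∷ X) = begin
  excess4 p (toℕ x) +ℤ sumExcess4 p X     ≤⟨ ℤ.+-mono-≤ (excess4-IsFraction h pr 1<n n<p (toℕ<n x) (proj₂ (fraction pr n<p (toℕ x))))
                                                        (sumExcess4-bound h pr 1<n n<p X) ⟩
  (w +ℤ + E) +ℤ (W +ℤ + (length X * E))   ≡⟨ interchange w W (+ E) (+ (length X * E)) ⟩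
  (w +ℤ W) +ℤ + (E + length X * E)        ∎
  where
  open ℤ.≤-Reasoning
  p = suc (2 * h)
  E = 4 * (p / n + n)
  w = weight p (fractionOf pr n<p x)
  W = sumℤ (map (weight p) (map (fractionOf pr n<p) X))
  interchange : ∀ a b c d → (a +ℤ c) +ℤ (b +ℤ d) ≡ (a +ℤ b) +ℤ (c +ℤ d)
  interchange = ℤ-ring

-- Parity, logarithms and the choice of constants

prime-odd : ∀ {p} → Prime p → 2 < p → ∃[ h ] p ≡ suc (2 * h)
prime-odd {p} pr 2<p with p % 2 | m≡m%n+[m/n]*n p 2 | m%n<n p 2
... | zero        | p≡ | _ with () ← prime⇒coprime pr 2<p (ℕ∣.divides (p / 2) p≡ , ℕ∣.∣-refl)
... | suc zero    | p≡ | _ = p / 2 , trans p≡ (cong suc (ℕ.*-comm (p / 2) 2))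
... | suc (suc _) | _  | s≤s (s≤s ())

n<2^[1+⌊log₂n⌋] : ∀ n → n < 2 ^ suc ⌊log₂ n ⌋
n<2^[1+⌊log₂n⌋] n = ℕ.≰⇒> λ 2^≤n → ℕ.1+n≰n (subst (_≤ ⌊log₂ n ⌋) (⌊log₂[2^n]⌋≡n (suc ⌊log₂ n ⌋)) (⌊log₂⌋-mono-≤ 2^≤n))

sumExcess4-odd : ∀ h {n} → let p = suc (2 * h) in Prime p → 1 < n → n < p → n * n ≤ p → ∀ l k → n < 2 ^ l → p < 2 ^ k →
  ∀ X → Unique X → length X ≡ n → sumExcess4 p X ≤ℤ + (2 * suc k * (suc l * p) + 8 * p)
sumExcess4-odd h {n@(suc _)} pr 1<n n<p n²≤p l k n<2^l p<2^k X uniq |X|≡n = begin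
  sumExcess4 p X                                                        ≤⟨ sumExcess4-bound h pr 1<n n<p X ⟩
  sumℤ (map (weight p) (map F X)) +ℤ + (length X * (4 * (p / n + n)))   ≤⟨ ℤ.+-mono-≤ main (+≤+ error) ⟩
  + (2 * suc k * (suc l * p)) +ℤ + (8 * p)                              ∎
  where
  open ℤ.≤-Reasoning
  p = suc (2 * h)
  F = fractionOf pr n<p

  F-∈ : ∀ {c} → c ∈ map F X → c ∈ fractions l k
  F-∈ c∈ with x , _ , refl ← ∈-map⁻ F c∈ = IsFraction-∈ {p} {n} pr 1<n {l} {k} n<2^l p<2^k (proj₂ (fraction pr n<p (toℕ x)))

  main : sumℤ (map (weight p) (map F X)) ≤ℤ + (2 * suc k * (suc l * p))
  main = ℤ.≤-trans (sumℤ-map-⊆ (weight p) (λ _ → +≤+ z≤n) (map⁺ (fractionOf-injective pr n<p) uniq) F-∈)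
                   (Σ-weight-fractions p l k)

  error : length X * (4 * (p / n + n)) ≤ 8 * p
  error = ℕ.≤-trans (ℕ.≤-reflexive (trans (cong (_* (4 * (p / n + n))) |X|≡n) (expand n (p / n))))
         (ℕ.≤-trans (ℕ.*-monoʳ-≤ 4 (ℕ.+-mono-≤ (m/n*n≤m p n) n²≤p)) (ℕ.≤-reflexive (double p)))
    where
    expand : ∀ n q → n * (4 * (q + n)) ≡ 4 * (q * n + n * n)
    expand = ℕ-ring
    double : ∀ p → 4 * (p + p) ≡ 8 * p
    double = ℕ-ring

-- Here `suc l` is the logarithm `L` of `n`, which encodes `1 ≤ L`. Additive constants are absorbed
-- into multiples of `L`: the numerators give `(1 + 2 * C) * L`, the denominators `3 * L`, and with
-- the factor 2 for signs this makes `6 * (1 + 2 * C)`. The remaining 8 is the accumulated sampling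
-- error.
polylog : ∀ C p l → 2 * suc (suc (suc l) * C) * (suc (suc (suc l)) * p) + 8 * p ≤ (6 * (1 + 2 * C) + 8) * p * suc l ^ 2
polylog C p l = begin
  2 * suc (suc L * C) * (suc (suc L) * p) + 8 * p              ≤⟨ ℕ.+-mono-≤ (ℕ.*-mono-≤ (ℕ.*-monoʳ-≤ 2 k-bound) (ℕ.*-monoˡ-≤ p l-bound))
                                                                             (ℕ.m≤m*n (8 * p) (L * L)) ⟩
  2 * ((1 + 2 * C) * L) * (3 * L * p) + 8 * p * (L * L)        ≡⟨ collect C p L ⟩
  (6 * (1 + 2 * C) + 8) * p * (L * L)                          ≡⟨ cong (λ z → (6 * (1 + 2 * C) + 8) * p * (L * z)) (ℕ.*-identityʳ L) ⟨
  (6 * (1 + 2 * C) + 8) * p * L ^ 2                            ∎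
  where
  open ℕ.≤-Reasoning
  L = suc l

  k-bound : suc (suc L * C) ≤ (1 + 2 * C) * L
  k-bound = subst (suc (suc L * C) ≤_) (slack C l) (ℕ.m≤m+n _ (l + C * l))
    where
    slack : ∀ C l → suc (suc (suc l) * C) + (l + C * l) ≡ (1 + 2 * C) * suc l
    slack = ℕ-ring

  l-bound : suc (suc L) ≤ 3 * L
  l-bound = subst (suc (suc L) ≤_) (slack l) (ℕ.m≤m+n _ (2 * l))
    where
    slack : ∀ l → suc (suc (suc l)) + 2 * l ≡ 3 * suc l
    slack = ℕ-ring

  collect : ∀ C p L → 2 * ((1 + 2 * C) * L) * (3 * L * p) + 8 * p * (L * L) ≡ (6 * (1 + 2 * C) + 8) * p * (L * L)
  collect = ℕ-ring

mainTheorem10 : (C : ℕ) →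
    ∃[ A ] ∃[ K ] ∃[ N₀ ] ((n p : ℕ) → N₀ ≤ n → Prime p →
    n ^ 6 ≤ p → p ≤ n ^ C →
    (X : List (Fin p)) → Unique X → length X ≡ n →
    sumExcess4 p X ≤ℤ + (A * p * (⌊log₂ n ⌋ ^ K)))
-- The exponent 2 is one logarithm for the numerators and one for the denominators. The threshold 2
-- makes the logarithm of `n` at least 1.
mainTheorem10 C = 6 * (1 + 2 * C) + 8 , 2 , 2 , bound
  where
  bound : (n p : ℕ) → 2 ≤ n → Prime p → n ^ 6 ≤ p → p ≤ n ^ C →
          (X : List (Fin p)) → Unique X → length X ≡ n →
          sumExcess4 p X ≤ℤ + ((6 * (1 + 2 * C) + 8) * p * (⌊log₂ n ⌋ ^ 2))
  bound n@(suc _) p 2≤n pr n⁶≤p p≤n^C X uniq |X|≡n = odd (prime-odd pr (ℕ.≤-<-trans 2≤n n<p))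
    where
    n²≤p : n * n ≤ p
    n²≤p = ℕ.≤-trans (ℕ.≤-trans (ℕ.≤-reflexive (cong (n *_) (sym (ℕ.*-identityʳ n)))) (ℕ.^-monoʳ-≤ n {2} {6} (s≤s (s≤s z≤n)))) n⁶≤p

    n<p : n < p
    n<p = ℕ.<-≤-trans (ℕ.m<m*n n n 2≤n) n²≤p

    1≤log : 1 ≤ ⌊log₂ n ⌋
    1≤log = ⌊log₂⌋-mono-≤ 2≤n

    l = suc ⌊log₂ n ⌋

    -- Here `p ≤ n ^ C` turns the logarithm of `p` into a multiple of that of `n`. The strict
    -- inequality `n < 2 ^ l` survives taking powers only for a positive exponent.
    p<2^k : 0 < C → p < 2 ^ (l * C)
    p<2^k 0<C = ℕ.≤-<-trans p≤n^C (subst (n ^ C <_) (ℕ.^-*-assoc 2 l C)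
                  (ℕ.^-monoˡ-< C {{>-nonZero 0<C}} (n<2^[1+⌊log₂n⌋] n)))

    0<C : 0 < C
    0<C = ℕ.n≢0⇒n>0 (λ { refl → ℕ.<⇒≱ (ℕ.<-trans (ℕ.<-≤-trans (s≤s z<s) 2≤n) n<p) p≤n^C })

    odd : ∃[ h ] p ≡ suc (2 * h) → sumExcess4 p X ≤ℤ + ((6 * (1 + 2 * C) + 8) * p * (⌊log₂ n ⌋ ^ 2))
    odd (h , refl) = ℤ.≤-trans
      (sumExcess4-odd h pr 2≤n n<p n²≤p l (l * C) (n<2^[1+⌊log₂n⌋] n) (p<2^k 0<C) X uniq |X|≡n)
      (+≤+ (log-bound ⌊log₂ n ⌋ 1≤log))
      where
      log-bound : ∀ L → 1 ≤ L → 2 * suc (suc L * C) * (suc (suc L) * p) + 8 * p ≤ (6 * (1 + 2 * C) + 8) * p * L ^ 2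
      log-bound (suc L) _ = polylog C p L
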